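{- For every real number $\epsilon>0$ and every fixed natural number $r\ge 2$, with probability tending to $1$ as $n\to\infty$, $$\chi\left(\widetilde{C}_{\mathrm{Hom}_p(K_r,\,G(n,\frac12))}\right)\leq \left(r+\frac{2}{r-1}+\epsilon\right)\log_2 n.$$
   Context: $G(n,p)$ is the random graph on labeled vertex set $[n]=\{1,\dots,n\}$ in which each edge appears independently with probability $p$. For graphs $F$ with $V(F)=[r]$ and $H$, the Hom-poset $\mathrm{Hom}_p(F,H)$ consists of all $r$-tuples $(A_1,\dots,A_r)$ of non-empty subsets of $V(H)$ such that for every edge $\{i,j\}$ of $F$ and every $x\in A_i$, $y\in A_j$, $\{x,y\}$ is an edge of $H$; it is ordered by $(A_1,\dots,A_r)\le(B_1,\dots,B_r)$ iff $A_i\subseteq B_i$ for all $i$. $K_r$ is the complete graph on $[r]$. The cyclic group $\mathbb{Z}_r=\{\omega^0=e,\omega,\dots,\omega^{r-1}\}$ acts on $\mathrm{Hom}_p(K_r,H)$ by cyclic shift: $\omega^i\cdot(A_1,\dots,A_r)=(A_{1+i},\dots,A_{r+i})$, indices taken modulo $r$ in $[r]$; this makes it a free $\mathbb{Z}_r$-poset. For a $G$-poset $P$ (order-preserving $G$-action) with $[x]=\{g\cdot x:g\in G\}$, the strong compatibility graph $\widetilde{C}_P$ has vertex set $P$, with $x,y$ adjacent if there is $g\in G\setminus\{e\}$ such that $x$ and $g\cdot y$ are comparable and $y\notin[x]$. $\chi$ is the chromatic number. -}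

module Defs where

open import Algebra.Bundles using (Group)
import Algebra.Properties.Group as GroupProperties
open import Data.Bool using (Bool; true; false; if_then_else_; T)
open import Data.Empty using (⊥; ⊥-elim)
open import Data.Fin using (Fin; zero; suc; toℕ)
import Data.Fin.Properties as Finₚ
open import Data.Fin.Subset using (Subset; _∈_; _⊆_; Nonempty)
import Data.Fin.Subset.Properties as Subsetₚ
open import Data.Integer using (+_; +≤+)
import Data.Integer as ℤ
import Data.Integer.Properties as ℤₚ
open import Data.List using (List; []; _∷_; map; foldr; cartesianProductWith)
open import Data.Nat using (ℕ; zero; suc; NonZero; _^_)
import Data.Nat as ℕ
import Data.Nat.Properties as ℕₚ
open import Data.Nat.DivMod using (_%_; _mod_; %-distribˡ-+; m%n%n≡m%n; m<n⇒m%n≡m; n%n≡0; m%n<n)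
open import Data.Product using (Σ; ∃; _×_; _,_; proj₁; proj₂)
open import Data.Rational using (ℚ; mkℚ; _/_; _<_; _≤_; _+_; _-_; _*_; -_; 0ℚ; 1ℚ; ½; ∣_∣; _⊔_; _⊓_; 1/_; Positive; positive; nonNegative; toℚᵘ)
import Data.Rational as ℚ
import Data.Rational.Properties as ℚₚ
open import Data.Rational.Solver using (module +-*-Solver)
open import Data.Rational.Unnormalised using (mkℚᵘ; *≤*; *<*; *≡*)
import Data.Rational.Unnormalised as ℚᵘ
import Data.Rational.Unnormalised.Properties as ℚᵘₚ
open import Data.Sum using (_⊎_; inj₁; inj₂; swap)
open import Data.Vec using (Vec; []; _∷_; lookup)
open import Level using (0ℓ)
open import Relation.Binary using (Poset; Rel; Setoid; tri<; tri≈; tri>)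
open import Relation.Binary.PropositionalEquality using (_≡_; _≢_; refl; sym; trans; cong; cong₂; subst; subst₂; setoid; isEquivalence; module ≡-Reasoning)
open import Relation.Nullary using (¬_; yes; no)

-- Real numbers: two-sided Dedekind cuts in ℚ.  Inhabitedness of both
-- halves and locatedness in the form  p < q → L p ⊎ U q  follow from
-- `located`.

record ℝ : Set₁ where
  field
    L U      : ℚ → Set
    L-down   : ∀ {p q} → p < q → L q → L p
    L-open   : ∀ {p} → L p → ∃ λ q → p < q × L q
    U-up     : ∀ {p q} → p < q → U p → U q
    U-open   : ∀ {q} → U q → ∃ λ p → p < q × U p
    disjoint : ∀ {q} → L q → U q → ⊥
    located  : ∀ δ → 0ℚ < δ → ∃ λ p → ∃ λ q → L p × U q × q < p + δ

open ℝ

infix 4 _≤ℝ_ _<ℝ_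
infixl 6 _+ℝ_
infixl 7 _*ℝ_

_≤ℝ_ : ℝ → ℝ → Set
x ≤ℝ y = ∀ q → L x q → L y q

_<ℝ_ : ℝ → ℝ → Set
x <ℝ y = ∃ λ q → U x q × L y q

private
  open +-*-Solver using (solve; _:=_; _:+_; _:*_; :-_; _:-_; con)

  0<- : ∀ {p q} → p < q → 0ℚ < q - p
  0<- {p} {q} p<q = subst (_< q - p) (ℚₚ.+-inverseʳ p) (ℚₚ.+-monoˡ-< (- p) p<q)

  <-by : ∀ {a b c d} → d - c ≡ b - a → a < b → c < d
  <-by {a} {b} {c} {d} e a<b = subst₂ _<_ (ℚₚ.+-identityˡ c)
    (trans (cong (_+ c) (sym e)) (solve 2 (λ d c → (d :- c) :+ c := d) refl d c))
    (ℚₚ.+-monoˡ-< c (0<- a<b))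

  ≤-by : ∀ {a b c d} → d - c ≡ b - a → a ≤ b → c ≤ d
  ≤-by {a} {b} {c} {d} e a≤b = subst₂ _≤_
    (solve 2 (λ a c → a :+ (c :- a) := c) refl a c)
    (trans (solve 3 (λ a b c → b :+ (c :- a) := (b :- a) :+ c) refl a b c)
      (trans (cong (_+ c) (sym e)) (solve 2 (λ d c → (d :- c) :+ c := d) refl d c)))
    (ℚₚ.+-monoˡ-≤ (c - a) a≤b)

  *-0< : ∀ {p q} → 0ℚ < p → 0ℚ < q → 0ℚ < p * q
  *-0< {p} {q} 0<p 0<q =
    ℚₚ.positive⁻¹ (p * q) {{ℚₚ.pos*pos⇒pos p {{positive 0<p}} q {{positive 0<q}}}}

  0<½ : 0ℚ < ½
  0<½ = ℚₚ.positive⁻¹ ½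

  half< : ∀ {δ} → 0ℚ < δ → 0ℚ < ½ * δ
  half< = *-0< 0<½

-- The real pinned down by rational lower bounds Lo and upper bounds Hi
-- that come arbitrarily close to each other.
cut : (Lo Hi : ℚ → Set) → (∀ {a b} → Lo a → Hi b → a ≤ b) →
      (∀ δ → 0ℚ < δ → ∃ λ a → ∃ λ b → Lo a × Hi b × b < a + δ) → ℝ
cut Lo Hi Lo≤Hi close = record
  { L        = λ q → ∃ λ a → Lo a × q < a
  ; U        = λ q → ∃ λ b → Hi b × b < q
  ; L-down   = λ p<q (a , la , q<a) → a , la , ℚₚ.<-trans p<q q<a
  ; L-open   = λ (a , la , p<a) → let (m , p<m , m<a) = ℚₚ.<-dense p<a in m , p<m , a , la , m<a
  ; U-up     = λ p<q (b , hb , b<p) → b , hb , ℚₚ.<-trans b<p p<q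
  ; U-open   = λ (b , hb , b<q) → let (m , b<m , m<q) = ℚₚ.<-dense b<q in m , m<q , b , hb , b<m
  ; disjoint = λ (a , la , q<a) (b , hb , b<q) →
      ℚₚ.<-irrefl refl (ℚₚ.<-≤-trans (ℚₚ.<-trans b<q q<a) (Lo≤Hi la hb))
  ; located  = λ δ 0<δ →
      let η = ½ * (½ * δ)
          0<η = half< (half< 0<δ)
          (a , b , la , hb , b<a+) = close (½ * δ) (half< 0<δ)
      in a - η , b + η
         , (a , la , <-by (solve 2 (λ a η → a :- (a :- η) := η :- con 0ℚ) refl a η) 0<η)
         , (b , hb , <-by (solve 2 (λ b η → (b :+ η) :- b := η :- con 0ℚ) refl b η) 0<η)
         , <-by (solve 3 (λ a b δ → ((a :- con ½ :* (con ½ :* δ)) :+ δ) :- (b :+ con ½ :* (con ½ :* δ))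
                                    := (a :+ con ½ :* δ) :- b) refl a b δ) b<a+
  }

fromℚ : ℚ → ℝ
fromℚ q = cut (_≡ q) (_≡ q) (λ { refl refl → ℚₚ.≤-refl })
  (λ δ 0<δ → q , q , refl , refl , <-by (solve 2 (λ q δ → (q :+ δ) :- q := δ :- con 0ℚ) refl q δ) 0<δ)

fromℕ : ℕ → ℝ
fromℕ k = fromℚ (+ k / 1)

private
  L<U : ∀ x {p q} → L x p → U x q → p < q
  L<U x {p} {q} lp uq with q ℚₚ.≤? p
  ... | no q≰p = ℚₚ.≰⇒> q≰p
  ... | yes q≤p with ℚₚ.<-cmp q p
  ...   | tri< q<p _ _ = ⊥-elim (disjoint x (L-down x q<p lp) uq)
  ...   | tri≈ _ refl _ = ⊥-elim (disjoint x lp uq)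
  ...   | tri> _ _ p<q = p<q

_+ℝ_ : ℝ → ℝ → ℝ
x +ℝ y = cut
  (λ c → ∃ λ a → ∃ λ b → L x a × L y b × c ≡ a + b)
  (λ c → ∃ λ a → ∃ λ b → U x a × U y b × c ≡ a + b)
  (λ { (a , b , la , lb , refl) (a′ , b′ , ua , ub , refl) →
       ℚₚ.<⇒≤ (ℚₚ.+-mono-< (L<U x la ua) (L<U y lb ub)) })
  (λ δ 0<δ →
    let (a , a′ , la , ua , a<) = located x (½ * δ) (half< 0<δ)
        (b , b′ , lb , ub , b<) = located y (½ * δ) (half< 0<δ)
    in a + b , a′ + b′ , (a , b , la , lb , refl) , (a′ , b′ , ua , ub , refl)
       , subst (a′ + b′ <_)
           (solve 3 (λ a b δ → (a :+ con ½ :* δ) :+ (b :+ con ½ :* δ) := (a :+ b) :+ δ) refl a b δ)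
           (ℚₚ.+-mono-< a< b<))

-- v bounds the product x y from below (above) when it does so for s t,
-- with s and t ranging over rational intervals around x and y.
module _ (x y : ℝ) where

  OnSomeBox : (ℚ → Set) → Set
  OnSomeBox P = ∃ λ a → ∃ λ b → ∃ λ c → ∃ λ d → L x a × U x b × L y c × U y d ×
    (∀ s t → a ≤ s → s ≤ b → c ≤ t → t ≤ d → P (s * t))

private
  ≤∣∣ : ∀ p → p ≤ ∣ p ∣
  ≤∣∣ p with ℚₚ.≤-total 0ℚ p
  ... | inj₁ 0≤p = ℚₚ.≤-reflexive (sym (ℚₚ.0≤p⇒∣p∣≡p 0≤p))
  ... | inj₂ p≤0 = ℚₚ.≤-trans p≤0 (ℚₚ.0≤∣p∣ p)

  -≤∣∣ : ∀ p → - p ≤ ∣ p ∣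
  -≤∣∣ p = subst (- p ≤_) (ℚₚ.∣-p∣≡∣p∣ p) (≤∣∣ (- p))

  ∣∣≤ : ∀ {p m} → p ≤ m → - p ≤ m → ∣ p ∣ ≤ m
  ∣∣≤ {p} {m} p≤m -p≤m with ℚₚ.∣p∣≡p∨∣p∣≡-p p
  ... | inj₁ e = subst (_≤ m) (sym e) p≤m
  ... | inj₂ e = subst (_≤ m) (sym e) -p≤m

  ≤+ʳ : ∀ {p q r} → p ≤ q → 0ℚ ≤ r → p ≤ q + r
  ≤+ʳ {p} p≤q 0≤r = subst (_≤ _) (ℚₚ.+-identityʳ p) (ℚₚ.+-mono-≤ p≤q 0≤r)

  ≤+ˡ : ∀ {p q r} → p ≤ r → 0ℚ ≤ q → p ≤ q + r
  ≤+ˡ {p} p≤r 0≤q = subst (_≤ _) (ℚₚ.+-identityˡ p) (ℚₚ.+-mono-≤ 0≤q p≤r)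

  ∣between∣ : ∀ {a b s} → a ≤ s → s ≤ b → ∣ s ∣ ≤ ∣ a ∣ + ∣ b ∣
  ∣between∣ {a} {b} {s} a≤s s≤b = ∣∣≤
    (≤+ˡ (ℚₚ.≤-trans s≤b (≤∣∣ b)) (ℚₚ.0≤∣p∣ a))
    (≤+ʳ (ℚₚ.≤-trans (ℚₚ.neg-antimono-≤ a≤s) (-≤∣∣ a)) (ℚₚ.0≤∣p∣ b))

  ∣*∣≤ : ∀ {p q m n} → ∣ p ∣ ≤ m → ∣ q ∣ ≤ n → ∣ p * q ∣ ≤ m * n
  ∣*∣≤ {p} {q} {m} {n} p≤m q≤n = subst (_≤ m * n) (sym (ℚₚ.∣p*q∣≡∣p∣*∣q∣ p q))
    (ℚₚ.≤-trans
      (ℚₚ.*-monoʳ-≤-nonNeg ∣ q ∣ {{ℚₚ.∣-∣-nonNeg q}} p≤m)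
      (ℚₚ.*-monoˡ-≤-nonNeg m {{nonNegative (ℚₚ.≤-trans (ℚₚ.0≤∣p∣ p) p≤m)}} q≤n))

  shrink : ∀ x {a₀ b₀} → L x a₀ → U x b₀ → ∀ η → 0ℚ < η →
           ∃ λ a → ∃ λ b → L x a × U x b × a₀ ≤ a × b ≤ b₀ × b < a + η
  shrink x {a₀} {b₀} la₀ ub₀ η 0<η with located x η 0<η
  ... | a₁ , b₁ , la₁ , ub₁ , b₁< = a₀ ⊔ a₁ , b₀ ⊓ b₁
    , sel⊔ (ℚₚ.⊔-sel a₀ a₁) , sel⊓ (ℚₚ.⊓-sel b₀ b₁)
    , ℚₚ.p≤p⊔q a₀ a₁ , ℚₚ.p⊓q≤p b₀ b₁
    , ℚₚ.≤-<-trans (ℚₚ.p⊓q≤q b₀ b₁) (ℚₚ.<-≤-trans b₁< (ℚₚ.+-monoˡ-≤ η (ℚₚ.p≤q⊔p a₀ a₁)))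
    where
    sel⊔ : a₀ ⊔ a₁ ≡ a₀ ⊎ a₀ ⊔ a₁ ≡ a₁ → L x (a₀ ⊔ a₁)
    sel⊔ (inj₁ e) = subst (L x) (sym e) la₀
    sel⊔ (inj₂ e) = subst (L x) (sym e) la₁
    sel⊓ : b₀ ⊓ b₁ ≡ b₀ ⊎ b₀ ⊓ b₁ ≡ b₁ → U x (b₀ ⊓ b₁)
    sel⊓ (inj₁ e) = subst (U x) (sym e) ub₀
    sel⊓ (inj₂ e) = subst (U x) (sym e) ub₁

  ∣within∣ : ∀ {a b s η} → a ≤ s → s ≤ b → b < a + η → 0ℚ < η → ∣ s - a ∣ ≤ η
  ∣within∣ {a} {b} {s} {η} a≤s s≤b b< 0<η = ∣∣≤
    (≤-by (solve 3 (λ s a η → η :- (s :- a) := (a :+ η) :- s) refl s a η)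
          (ℚₚ.≤-trans s≤b (ℚₚ.<⇒≤ b<)))
    (ℚₚ.≤-trans (≤-by (solve 2 (λ s a → con 0ℚ :- (:- (s :- a)) := s :- a) refl s a) a≤s) (ℚₚ.<⇒≤ 0<η))

  max< : ∀ {a b c} → a < c → b < c → a ⊔ b < c
  max< {a} {b} {c} a<c b<c with ℚₚ.⊔-sel a b
  ... | inj₁ e = subst (_< c) (sym e) a<c
  ... | inj₂ e = subst (_< c) (sym e) b<c

  box≤ : ∀ x y {v w} → OnSomeBox x y (v ≤_) → OnSomeBox x y (_≤ w) → v ≤ w
  box≤ x y (a , b , c , d , la , ub , lc , ud , lo) (a′ , b′ , c′ , d′ , la′ , ub′ , lc′ , ud′ , hi) =
    ℚₚ.≤-trans
      (lo (a ⊔ a′) (c ⊔ c′) (ℚₚ.p≤p⊔q a a′) (≤m x la la′ ub) (ℚₚ.p≤p⊔q c c′) (≤m y lc lc′ ud))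
      (hi (a ⊔ a′) (c ⊔ c′) (ℚₚ.p≤q⊔p a a′) (≤m x la la′ ub′) (ℚₚ.p≤q⊔p c c′) (≤m y lc lc′ ud′))
    where
    ≤m : ∀ z {p q r} → L z p → L z q → U z r → p ⊔ q ≤ r
    ≤m z lp lq ur = ℚₚ.<⇒≤ (max< (L<U z lp ur) (L<U z lq ur))

  small : ∀ M δ → 0ℚ < M → 0ℚ < δ →
          ∃ λ η → 0ℚ < η × (M * η + M * η) + (M * η + M * η) < δ
  small M δ 0<M 0<δ = i * h , *-0< 0<i (half< (half< (half< 0<δ)))
    , subst (λ e → (e + e) + (e + e) < δ) (sym M*η≡h)
        (<-by (solve 1 (λ δ → let h = con ½ :* (con ½ :* (con ½ :* δ)) in
                 δ :- ((h :+ h) :+ (h :+ h)) := con ½ :* δ :- con 0ℚ) refl δ)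
              (half< 0<δ))
    where
    instance
      M-pos : Positive M
      M-pos = positive 0<M
    i h : ℚ
    i = (1/ M) {{ℚₚ.pos⇒nonZero M}}
    h = ½ * (½ * (½ * δ))
    0<i : 0ℚ < i
    0<i = ℚₚ.positive⁻¹ i {{ℚₚ.1/pos⇒pos M}}
    M*η≡h : M * (i * h) ≡ h
    M*η≡h = trans (sym (ℚₚ.*-assoc M i h))
      (trans (cong (_* h) (ℚₚ.*-inverseʳ M {{ℚₚ.pos⇒nonZero M}})) (ℚₚ.*-identityˡ h))

  near : ∀ s t a c e → ∣ s * (t - c) ∣ ≤ e → ∣ c * (s - a) ∣ ≤ e →
         a * c - (e + e) ≤ s * t × s * t ≤ a * c + (e + e)
  near s t a c e bound₁ bound₂ =
      ≤-by (solve 5 (λ s t a c e → s :* t :- (a :* c :- (e :+ e)) :=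
              (e :+ e) :- (:- (s :* (t :- c)) :+ :- (c :* (s :- a)))) refl s t a c e)
        (ℚₚ.+-mono-≤ (ℚₚ.≤-trans (-≤∣∣ _) bound₁) (ℚₚ.≤-trans (-≤∣∣ _) bound₂))
    , ≤-by (solve 5 (λ s t a c e → (a :* c :+ (e :+ e)) :- s :* t :=
              (e :+ e) :- (s :* (t :- c) :+ c :* (s :- a))) refl s t a c e)
        (ℚₚ.+-mono-≤ (ℚₚ.≤-trans (≤∣∣ _) bound₁) (ℚₚ.≤-trans (≤∣∣ _) bound₂))

  gap : ∀ k e δ → (e + e) + (e + e) < δ → k + (e + e) < (k - (e + e)) + δ
  gap k e δ = <-by (solve 3 (λ k e δ → ((k :- (e :+ e)) :+ δ) :- (k :+ (e :+ e)) :=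
                                       δ :- ((e :+ e) :+ (e :+ e))) refl k e δ)

  bounded : ∀ x y → ∃ λ M → 0ℚ < M ×
    ∃ λ a → ∃ λ b → ∃ λ c → ∃ λ d → L x a × U x b × L y c × U y d ×
    (∀ s → a ≤ s → s ≤ b → ∣ s ∣ ≤ M) × (∀ t → c ≤ t → t ≤ d → ∣ t ∣ ≤ M)
  bounded x y with located x 1ℚ (ℚₚ.positive⁻¹ 1ℚ) | located y 1ℚ (ℚₚ.positive⁻¹ 1ℚ)
  ... | a , b , la , ub , _ | c , d , lc , ud , _ =
    (M₁ + M₂) + 1ℚ , ℚₚ.+-mono-≤-< (≤+ʳ 0≤M₁ 0≤M₂) (ℚₚ.positive⁻¹ 1ℚ)
    , a , b , c , d , la , ub , lc , ud
    , (λ s a≤s s≤b → ℚₚ.≤-trans (∣between∣ a≤s s≤b) (≤+ʳ (≤+ʳ ℚₚ.≤-refl 0≤M₂) 0≤1))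
    , (λ t c≤t t≤d → ℚₚ.≤-trans (∣between∣ c≤t t≤d) (≤+ʳ (≤+ˡ ℚₚ.≤-refl 0≤M₁) 0≤1))
    where
    M₁ M₂ : ℚ
    M₁ = ∣ a ∣ + ∣ b ∣
    M₂ = ∣ c ∣ + ∣ d ∣
    0≤M₁ : 0ℚ ≤ M₁
    0≤M₁ = ≤+ʳ (ℚₚ.0≤∣p∣ a) (ℚₚ.0≤∣p∣ b)
    0≤M₂ : 0ℚ ≤ M₂
    0≤M₂ = ≤+ʳ (ℚₚ.0≤∣p∣ c) (ℚₚ.0≤∣p∣ d)
    0≤1 : 0ℚ ≤ 1ℚ
    0≤1 = ℚₚ.<⇒≤ (ℚₚ.positive⁻¹ 1ℚ)

  box-close : ∀ x y δ → 0ℚ < δ →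
    ∃ λ v → ∃ λ w → OnSomeBox x y (v ≤_) × OnSomeBox x y (_≤ w) × w < v + δ
  box-close x y δ 0<δ =
    let (M , 0<M , a₀ , b₀ , c₀ , d₀ , la₀ , ub₀ , lc₀ , ud₀ , bx , by) = bounded x y
        (η , 0<η , 4Mη<δ) = small M δ 0<M 0<δ
        (a , b , la , ub , a₀≤a , b≤b₀ , b<) = shrink x la₀ ub₀ η 0<η
        (c , d , lc , ud , c₀≤c , d≤d₀ , d<) = shrink y lc₀ ud₀ η 0<η
        nearby : ∀ s t → a ≤ s → s ≤ b → c ≤ t → t ≤ d →
          a * c - (M * η + M * η) ≤ s * t × s * t ≤ a * c + (M * η + M * η)
        nearby = λ s t a≤s s≤b c≤t t≤d → near s t a c (M * η)
          (∣*∣≤ {s} {t - c} {M} {η} (bx s (ℚₚ.≤-trans a₀≤a a≤s) (ℚₚ.≤-trans s≤b b≤b₀))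
            (∣within∣ {c} {d} c≤t t≤d d< 0<η))
          (∣*∣≤ {c} {s - a} {M} {η} (by c c₀≤c (ℚₚ.≤-trans c≤t (ℚₚ.≤-trans t≤d d≤d₀)))
            (∣within∣ {a} {b} a≤s s≤b b< 0<η))
    in a * c - (M * η + M * η) , a * c + (M * η + M * η)
      , (a , b , c , d , la , ub , lc , ud , λ s t p q u w → proj₁ (nearby s t p q u w))
      , (a , b , c , d , la , ub , lc , ud , λ s t p q u w → proj₂ (nearby s t p q u w))
      , gap (a * c) (M * η) δ 4Mη<δ

_*ℝ_ : ℝ → ℝ → ℝ
x *ℝ y = cut (λ v → OnSomeBox x y (v ≤_)) (λ w → OnSomeBox x y (_≤ w)) (box≤ x y) (box-close x y)

private
  log-≤ : ∀ n {a b d e} → 2 ^ a ℕ.≤ n ^ suc d → n ^ suc e ℕ.≤ 2 ^ b → + a / suc d ≤ + b / suc e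
  log-≤ n {a} {b} {d} {e} lo hi = ℚₚ.toℚᵘ-cancel-≤
    (ℚᵘₚ.≤-respˡ-≃ (ℚᵘₚ.≃-sym (ℚₚ.toℚᵘ-fromℚᵘ (mkℚᵘ (+ a) d)))
      (ℚᵘₚ.≤-respʳ-≃ (ℚᵘₚ.≃-sym (ℚₚ.toℚᵘ-fromℚᵘ (mkℚᵘ (+ b) e)))
        (*≤* (subst₂ ℤ._≤_ (ℤₚ.pos-* a (suc e)) (ℤₚ.pos-* b (suc d)) (+≤+ cross)))))
    where
    open ℕₚ.≤-Reasoning
    powers : 2 ^ (a ℕ.* suc e) ℕ.≤ 2 ^ (b ℕ.* suc d)
    powers = begin
      2 ^ (a ℕ.* suc e)     ≡⟨ ℕₚ.^-*-assoc 2 a (suc e) ⟨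
      (2 ^ a) ^ suc e       ≤⟨ ℕₚ.^-monoˡ-≤ (suc e) lo ⟩
      (n ^ suc d) ^ suc e   ≡⟨ ℕₚ.^-*-assoc n (suc d) (suc e) ⟩
      n ^ (suc d ℕ.* suc e) ≡⟨ cong (n ^_) (ℕₚ.*-comm (suc d) (suc e)) ⟩
      n ^ (suc e ℕ.* suc d) ≡⟨ ℕₚ.^-*-assoc n (suc e) (suc d) ⟨
      (n ^ suc e) ^ suc d   ≤⟨ ℕₚ.^-monoˡ-≤ (suc d) hi ⟩
      (2 ^ b) ^ suc d       ≡⟨ ℕₚ.^-*-assoc 2 b (suc d) ⟩
      2 ^ (b ℕ.* suc d)     ∎
    cross : a ℕ.* suc e ℕ.≤ b ℕ.* suc d
    cross = ℕₚ.≮⇒≥ (λ lt → ℕₚ.<⇒≱ (ℕₚ.^-monoʳ-< 2 (ℕ.s≤s (ℕ.s≤s ℕ.z≤n)) lt) powers)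

  floor-log : ∀ m → 1 ℕ.≤ m → ∃ λ j → 2 ^ j ℕ.≤ m × m ℕ.< 2 ^ suc j
  floor-log (suc zero) _ = 0 , ℕₚ.≤-refl , ℕₚ.≤-refl
  floor-log (suc m@(suc _)) _ with floor-log m (ℕ.s≤s ℕ.z≤n)
  ... | j , lo , hi with suc m ℕₚ.<? 2 ^ suc j
  ...   | yes hi′ = j , ℕₚ.m≤n⇒m≤1+n lo , hi′
  ...   | no ≮ = suc j , ℕₚ.≮⇒≥ ≮
                , ℕₚ.≤-<-trans hi (ℕₚ.^-monoʳ-< 2 (ℕ.s≤s (ℕ.s≤s ℕ.z≤n)) {suc j} ℕₚ.≤-refl)

  archimedes : ∀ δ → 0ℚ < δ → ∃ λ d → + 1 / suc d < δ
  archimedes δ@(mkℚ (+ suc a) d _) _ = suc d , ℚₚ.toℚᵘ-cancel-<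
    (ℚᵘₚ.<-respˡ-≃ (ℚᵘₚ.≃-sym (ℚₚ.toℚᵘ-fromℚᵘ (mkℚᵘ (+ 1) (suc d))))
      (*<* (subst₂ ℤ._<_ (ℤₚ.pos-* 1 (suc d)) (ℤₚ.pos-* (suc a) (suc (suc d)))
        (ℤ.+<+ (ℕₚ.<-≤-trans (subst (ℕ._< suc (suc d)) (sym (ℕₚ.*-identityˡ (suc d))) ℕₚ.≤-refl)
                             (ℕₚ.m≤m+n (suc (suc d)) (a ℕ.* suc (suc d))))))))
  archimedes (mkℚ (+ zero) d _) (ℚ.*<* (ℤ.+<+ ()))
  archimedes (mkℚ ℤ.-[1+ a ] d _) (ℚ.*<* ())

  suc/ : ∀ j d → + suc j / suc d ≡ + j / suc d + + 1 / suc d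
  suc/ j d = ℚₚ.toℚᵘ-injective (begin
    toℚᵘ (+ suc j / suc d)                        ≈⟨ ℚₚ.toℚᵘ-fromℚᵘ (mkℚᵘ (+ suc j) d) ⟩
    mkℚᵘ (+ suc j) d                              ≈⟨ *≡* eq ⟩
    mkℚᵘ (+ j) d ℚᵘ.+ mkℚᵘ (+ 1) d                ≈⟨ ℚᵘₚ.+-cong (ℚₚ.toℚᵘ-fromℚᵘ (mkℚᵘ (+ j) d)) (ℚₚ.toℚᵘ-fromℚᵘ (mkℚᵘ (+ 1) d)) ⟨
    toℚᵘ (+ j / suc d) ℚᵘ.+ toℚᵘ (+ 1 / suc d)    ≈⟨ ℚₚ.toℚᵘ-homo-+ (+ j / suc d) (+ 1 / suc d) ⟨
    toℚᵘ (+ j / suc d + + 1 / suc d)              ∎)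
    where
    open ℚᵘₚ.≃-Reasoning
    D = + suc d
    eq : + suc j ℤ.* (D ℤ.* D) ≡ (+ j ℤ.* D ℤ.+ + 1 ℤ.* D) ℤ.* D
    eq = trans (sym (ℤₚ.*-assoc (+ suc j) D D)) (cong (ℤ._* D)
           (trans (cong (ℤ._* D) (trans (cong +_ (sym (ℕₚ.+-comm j 1))) (ℤₚ.pos-+ j 1)))
                  (ℤₚ.*-distribʳ-+ D (+ j) (+ 1))))

-- 2^(a/d) ≤ n ⇔ 2^a ≤ n^d, and dually.
log₂ : (n : ℕ) .{{_ : NonZero n}} → ℝ
log₂ n = cut
  (λ q → ∃ λ a → ∃ λ d → 2 ^ a ℕ.≤ n ^ suc d × q ≡ + a / suc d)
  (λ q → ∃ λ a → ∃ λ d → n ^ suc d ℕ.≤ 2 ^ a × q ≡ + a / suc d)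
  (λ { (a , d , lo , refl) (b , e , hi , refl) → log-≤ n {a} {b} {d} {e} lo hi })
  (λ δ 0<δ →
    let (d , 1/d<δ) = archimedes δ 0<δ
        (j , lo , hi) = floor-log (n ^ suc d) (ℕₚ.m^n>0 n (suc d))
    in + j / suc d , + suc j / suc d , (j , d , lo , refl) , (suc j , d , ℕₚ.<⇒≤ hi , refl)
       , subst (_< + j / suc d + δ) (sym (suc/ j d)) (ℚₚ.+-monoʳ-< (+ j / suc d) 1/d<δ))

record GraphOn (V : Setoid 0ℓ 0ℓ) : Set₁ where
  open Setoid V using (Carrier; _≈_)
  field
    Adj        : Rel Carrier 0ℓ
    Adj-resp   : ∀ {x x′ y y′} → x ≈ x′ → y ≈ y′ → Adj x y → Adj x′ y′
    Adj-sym    : ∀ {x y} → Adj x y → Adj y x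
    Adj-irrefl : ∀ {x} → ¬ Adj x x

open GraphOn public

FinGraph : ℕ → Set₁
FinGraph n = GraphOn (setoid (Fin n))

record Colouring {V : Setoid 0ℓ 0ℓ} (G : GraphOn V) (k : ℕ) : Set where
  open Setoid V using (Carrier; _≈_)
  field
    colour      : Carrier → Fin k
    colour-cong : ∀ {x y} → x ≈ y → colour x ≡ colour y
    proper      : ∀ {x y} → Adj G x y → colour x ≢ colour y

IsChromaticNumber : {V : Setoid 0ℓ 0ℓ} → GraphOn V → ℕ → Set
IsChromaticNumber G k = Colouring G k × (∀ m → Colouring G m → k ℕ.≤ m)

infix 4 χ[_]≤_

-- The witness k is χ(G), which is unique.
χ[_]≤_ : {V : Setoid 0ℓ 0ℓ} → GraphOn V → ℝ → Set
χ[ G ]≤ x = ∃ λ k → IsChromaticNumber G k × fromℕ k ≤ℝ x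

K : (r : ℕ) → FinGraph r
K r = record
  { Adj        = _≢_
  ; Adj-resp   = λ { refl refl x≢y → x≢y }
  ; Adj-sym    = λ x≢y y≡x → x≢y (sym y≡x)
  ; Adj-irrefl = λ x≢x → x≢x refl
  }

record HomTuple {r n : ℕ} (F : FinGraph r) (H : FinGraph n) : Set where
  field
    part     : Fin r → Subset n
    nonempty : ∀ i → Nonempty (part i)
    complete : ∀ {i j} → Adj F i j → ∀ {x y} → x ∈ part i → y ∈ part j → Adj H x y

open HomTuple public

Homₚ : {r n : ℕ} → FinGraph r → FinGraph n → Poset 0ℓ 0ℓ 0ℓ
Homₚ F H = record
  { Carrier = HomTuple F H
  ; _≈_ = λ A B → ∀ i → part A i ≡ part B i
  ; _≤_ = λ A B → ∀ i → part A i ⊆ part B i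
  ; isPartialOrder = record
    { isPreorder = record
      { isEquivalence = record
        { refl  = λ i → refl
        ; sym   = λ e i → sym (e i)
        ; trans = λ e f i → trans (e i) (f i)
        }
      ; reflexive = λ e i → Subsetₚ.⊆-reflexive (e i)
      ; trans     = λ A≤B B≤C i x∈A → B≤C i (A≤B i x∈A)
      }
    ; antisym = λ A≤B B≤A i → Subsetₚ.⊆-antisym (A≤B i) (B≤A i)
    }
  }

record GPoset (G : Group 0ℓ 0ℓ) : Set₁ where
  open Group G using (_∙_; ε) renaming (Carrier to ∣G∣; _≈_ to _≈ᴳ_)
  infixr 7 _·_
  field
    poset : Poset 0ℓ 0ℓ 0ℓ
  open Poset poset public using (Carrier; _≈_) renaming (_≤_ to _⊑_)
  field
    _·_    : ∣G∣ → Carrier → Carrier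
    ·-cong : ∀ {g h x y} → g ≈ᴳ h → x ≈ y → g · x ≈ h · y
    ·-ε    : ∀ x → ε · x ≈ x
    ·-∙    : ∀ g h x → (g ∙ h) · x ≈ g · (h · x)
    ·-mono : ∀ g {x y} → x ⊑ y → g · x ⊑ g · y

  Comparable : Rel Carrier 0ℓ
  Comparable x y = x ⊑ y ⊎ y ⊑ x

  _∈Orbit_ : Rel Carrier 0ℓ
  y ∈Orbit x = ∃ λ g → y ≈ g · x

module _ {G : Group 0ℓ 0ℓ} (P : GPoset G) where
  open Group G using (ε; _⁻¹; inverseˡ) renaming (_≈_ to _≈ᴳ_; refl to reflᴳ; sym to symᴳ; trans to transᴳ)
  open GroupProperties G using (ε⁻¹≈ε; ⁻¹-injective)
  open GPoset P
  open Poset poset using (module Eq; ≤-resp-≈)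

  StrongAdj : Rel Carrier 0ℓ
  StrongAdj x y = (∃ λ g → ¬ (g ≈ᴳ ε) × Comparable x (g · y)) × ¬ (y ∈Orbit x)

  private
    ·-inv : ∀ g x → g ⁻¹ · (g · x) ≈ x
    ·-inv g x = Eq.trans (Eq.sym (·-∙ (g ⁻¹) g x)) (Eq.trans (·-cong (inverseˡ g) Eq.refl) (·-ε x))

    orbit-sym : ∀ {x y} → y ∈Orbit x → x ∈Orbit y
    orbit-sym {x} (g , y≈gx) = g ⁻¹ , Eq.trans (Eq.sym (·-inv g x)) (·-cong reflᴳ (Eq.sym y≈gx))

    comparable-resp : ∀ {x x′ y y′} → x ≈ x′ → y ≈ y′ → Comparable x y → Comparable x′ y′
    comparable-resp e f (inj₁ x≤y) = inj₁ (proj₁ ≤-resp-≈ f (proj₂ ≤-resp-≈ e x≤y))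
    comparable-resp e f (inj₂ y≤x) = inj₂ (proj₁ ≤-resp-≈ e (proj₂ ≤-resp-≈ f y≤x))

    comparable-act : ∀ g {x y} → Comparable x y → Comparable (g · x) (g · y)
    comparable-act g (inj₁ x≤y) = inj₁ (·-mono g x≤y)
    comparable-act g (inj₂ y≤x) = inj₂ (·-mono g y≤x)

  strongCompatibilityGraph : GraphOn Eq.setoid
  strongCompatibilityGraph = record
    { Adj        = StrongAdj
    ; Adj-resp   = λ e f ((g , g≉ε , c) , y∉) →
        (g , g≉ε , comparable-resp e (·-cong reflᴳ f) c)
        , λ (h , y′≈hx′) → y∉ (h , Eq.trans f (Eq.trans y′≈hx′ (·-cong reflᴳ (Eq.sym e))))
    ; Adj-sym    = λ {x} {y} ((g , g≉ε , c) , y∉) →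
        (g ⁻¹ , (λ g⁻¹≈ε → g≉ε (⁻¹-injective (transᴳ g⁻¹≈ε (symᴳ ε⁻¹≈ε))))
              , swap (comparable-resp Eq.refl (·-inv g y) (comparable-act (g ⁻¹) c)))
        , λ x∈ → y∉ (orbit-sym x∈)
    ; Adj-irrefl = λ {x} (_ , x∉) → x∉ (ε , Eq.sym (·-ε x))
    }

module _ (r : ℕ) .{{_ : NonZero r}} where

  infixl 6 _⊕_

  _⊕_ : Fin r → Fin r → Fin r
  i ⊕ j = (toℕ i ℕ.+ toℕ j) mod r

  private
    toℕ-mod : ∀ m → toℕ (m mod r) ≡ m % r
    toℕ-mod m = Finₚ.toℕ-fromℕ< (m%n<n m r)

    mod-cong : ∀ {m n} → m % r ≡ n % r → m mod r ≡ n mod r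
    mod-cong {m} {n} e = Finₚ.toℕ-injective (trans (toℕ-mod m) (trans e (sym (toℕ-mod n))))

    toℕ-% : ∀ (i : Fin r) → toℕ i % r ≡ toℕ i
    toℕ-% i = m<n⇒m%n≡m (Finₚ.toℕ<n i)

    mod-toℕ : ∀ (i : Fin r) → toℕ i mod r ≡ i
    mod-toℕ i = Finₚ.toℕ-injective (trans (toℕ-mod (toℕ i)) (toℕ-% i))

    %-absorbˡ : ∀ m n → (m % r ℕ.+ n) % r ≡ (m ℕ.+ n) % r
    %-absorbˡ m n = trans (%-distribˡ-+ (m % r) n r)
      (trans (cong (λ k → (k ℕ.+ n % r) % r) (m%n%n≡m%n m r)) (sym (%-distribˡ-+ m n r)))

    mod-⊕ : ∀ m (i : Fin r) → (m mod r) ⊕ i ≡ (m ℕ.+ toℕ i) mod r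
    mod-⊕ m i = mod-cong (trans (cong (λ k → (k ℕ.+ toℕ i) % r) (toℕ-mod m)) (%-absorbˡ m (toℕ i)))

    ⊕-comm : ∀ i j → i ⊕ j ≡ j ⊕ i
    ⊕-comm i j = cong (_mod r) (ℕₚ.+-comm (toℕ i) (toℕ j))

    ⊕-assoc : ∀ i j k → (i ⊕ j) ⊕ k ≡ i ⊕ (j ⊕ k)
    ⊕-assoc i j k = begin
      (i ⊕ j) ⊕ k                                  ≡⟨ mod-⊕ (toℕ i ℕ.+ toℕ j) k ⟩
      (toℕ i ℕ.+ toℕ j ℕ.+ toℕ k) mod r            ≡⟨ cong (_mod r) (ℕₚ.+-assoc (toℕ i) (toℕ j) (toℕ k)) ⟩
      (toℕ i ℕ.+ (toℕ j ℕ.+ toℕ k)) mod r          ≡⟨ cong (_mod r) (ℕₚ.+-comm (toℕ i) (toℕ j ℕ.+ toℕ k)) ⟩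
      (toℕ j ℕ.+ toℕ k ℕ.+ toℕ i) mod r            ≡⟨ mod-⊕ (toℕ j ℕ.+ toℕ k) i ⟨
      (j ⊕ k) ⊕ i                                  ≡⟨ ⊕-comm (j ⊕ k) i ⟩
      i ⊕ (j ⊕ k)                                  ∎
      where open ≡-Reasoning

    ⊕-identityˡ : ∀ i → (0 mod r) ⊕ i ≡ i
    ⊕-identityˡ i = trans (mod-⊕ 0 i) (mod-toℕ i)

    ⊖_ : Fin r → Fin r
    ⊖ i = (r ℕ.∸ toℕ i) mod r

    ⊕-inverseˡ : ∀ i → (⊖ i) ⊕ i ≡ 0 mod r
    ⊕-inverseˡ i = trans (mod-⊕ (r ℕ.∸ toℕ i) i)
      (trans (cong (_mod r) (ℕₚ.m∸n+n≡m (ℕₚ.<⇒≤ (Finₚ.toℕ<n i))))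
        (mod-cong (trans (n%n≡0 r) (sym (m<n⇒m%n≡m (ℕ.>-nonZero⁻¹ r))))))

  ℤ/ : Group 0ℓ 0ℓ
  ℤ/ = record
    { Carrier = Fin r
    ; _≈_     = _≡_
    ; _∙_     = _⊕_
    ; ε       = 0 mod r
    ; _⁻¹     = ⊖_
    ; isGroup = record
      { isMonoid = record
        { isSemigroup = record
          { isMagma = record { isEquivalence = isEquivalence ; ∙-cong = cong₂ _⊕_ }
          ; assoc   = ⊕-assoc
          }
        ; identity = ⊕-identityˡ , λ i → trans (⊕-comm i (0 mod r)) (⊕-identityˡ i)
        }
      ; inverse = ⊕-inverseˡ , λ i → trans (⊕-comm i (⊖ i)) (⊕-inverseˡ i)
      ; ⁻¹-cong = cong ⊖_
      }
    }

  shiftPoset : {n : ℕ} → FinGraph n → GPoset ℤ/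
  shiftPoset H = record
    { poset  = Homₚ (K r) H
    ; _·_    = λ i A → record
      { part     = λ j → part A (j ⊕ i)
      ; nonempty = λ j → nonempty A (j ⊕ i)
      ; complete = λ {j} {k} j≢k → complete A (λ e → j≢k (GroupProperties.∙-cancelʳ ℤ/ i j k e))
      }
    ; ·-cong = λ { {g = i} refl A≈B j → A≈B (j ⊕ i) }
    ; ·-ε    = λ A j → cong (part A) (trans (⊕-comm j (0 mod r)) (⊕-identityˡ j))
    ; ·-∙    = λ i k A j → cong (part A) (sym (⊕-assoc j i k))
    ; ·-mono = λ i A≤B j → A≤B (j ⊕ i)
    }

-- A graph on Fin (suc n) is the indicator of the neighbours of vertex
-- zero among the remaining vertices, followed by the graph they span;
-- so each labelled graph is listed once, with one bit per pair.
data EdgeBits : ℕ → Set where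
  []  : EdgeBits zero
  _∷_ : ∀ {n} → Vec Bool n → EdgeBits n → EdgeBits (suc n)

isEdge : ∀ {n} → EdgeBits n → Fin n → Fin n → Bool
isEdge (v ∷ ω) zero    zero    = false
isEdge (v ∷ ω) zero    (suc j) = lookup v j
isEdge (v ∷ ω) (suc i) zero    = lookup v i
isEdge (v ∷ ω) (suc i) (suc j) = isEdge ω i j

private
  isEdge-sym : ∀ {n} (ω : EdgeBits n) i j → isEdge ω i j ≡ isEdge ω j i
  isEdge-sym (v ∷ ω) zero    zero    = refl
  isEdge-sym (v ∷ ω) zero    (suc j) = refl
  isEdge-sym (v ∷ ω) (suc i) zero    = refl
  isEdge-sym (v ∷ ω) (suc i) (suc j) = isEdge-sym ω i j

  isEdge-irrefl : ∀ {n} (ω : EdgeBits n) i → isEdge ω i i ≡ false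
  isEdge-irrefl (v ∷ ω) zero    = refl
  isEdge-irrefl (v ∷ ω) (suc i) = isEdge-irrefl ω i

graph : ∀ {n} → EdgeBits n → FinGraph n
graph ω = record
  { Adj        = λ i j → T (isEdge ω i j)
  ; Adj-resp   = λ { refl refl e → e }
  ; Adj-sym    = λ {i} {j} → subst T (isEdge-sym ω i j)
  ; Adj-irrefl = λ {i} → subst T (isEdge-irrefl ω i)
  }

allBits : ∀ n → List (Vec Bool n)
allBits zero    = [] ∷ []
allBits (suc n) = cartesianProductWith _∷_ (true ∷ false ∷ []) (allBits n)

allEdgeBits : ∀ n → List (EdgeBits n)
allEdgeBits zero    = [] ∷ []
allEdgeBits (suc n) = cartesianProductWith _∷_ (allBits n) (allEdgeBits n)

bitsWeight : ∀ {n} → ℚ → Vec Bool n → ℚ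
bitsWeight p []          = 1ℚ
bitsWeight p (true  ∷ v) = p * bitsWeight p v
bitsWeight p (false ∷ v) = (1ℚ - p) * bitsWeight p v

weight : ∀ {n} → ℚ → EdgeBits n → ℚ
weight p []      = 1ℚ
weight p (v ∷ ω) = bitsWeight p v * weight p ω

-- ℙ(G(n,p) ∈ D) for a decidable set D of graphs.
ℙ : ℚ → ∀ {n} → (EdgeBits n → Bool) → ℚ
ℙ p {n} D = foldr _+_ 0ℚ (map (λ ω → if D ω then weight p ω else 0ℚ) (allEdgeBits n))

-- ℙ(E) ≥ q.  The comparison of reals inside an event is not decidable,
-- so the bound is witnessed by a decidable D ⊆ E; if E is itself
-- decidable this amounts to q ≤ ℙ p E.
ℙ[_,_]_≥_ : ℚ → (n : ℕ) → (EdgeBits n → Set) → ℚ → Set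
ℙ[ p , n ] E ≥ q = Σ (EdgeBits n → Bool) λ D → (∀ ω → T (D ω) → E ω) × q ≤ ℙ p D

WithHighProbability : ℚ → ((n : ℕ) .{{_ : NonZero n}} → EdgeBits n → Set) → Set
WithHighProbability p E = ∀ δ → 0ℚ < δ →
  ∃ λ N → ∀ n .{{_ : NonZero n}} → N ℕ.≤ n → ℙ[ p , n ] E n ≥ (1ℚ - δ)

2≤⇒nonZero : ∀ {r} → 2 ℕ.≤ r → NonZero r
2≤⇒nonZero (ℕ.s≤s _) = _

2≤⇒nonZero-∸1 : ∀ {r} → 2 ℕ.≤ r → NonZero (r ℕ.∸ 1)
2≤⇒nonZero-∸1 (ℕ.s≤s (ℕ.s≤s _)) = _

{-# OPTIONS --safe #-}
module Submission where

-- Call a graph good if no 2h of its vertices can be split into r classes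
-- of at most h vertices each with all pairs across classes adjacent.  Such
-- a configuration has at least h² prescribed edges, and there are at most
-- (rn)^(2h) of them, so for h = 2 log₂ n + O(1) the first moment method
-- shows that G(n,½) is good with probability close to 1.
--
-- Over a good graph, a tuple has at most one part with h or more vertices,
-- and a tuple without such a part covers fewer than 2h vertices.  Colour a
-- tuple by the position of its huge part if it has one, and by the number
-- of vertices it covers otherwise.  If A is comparable with a nontrivial
-- shift of B, then huge parts sit at different positions in A and B; if
-- neither has a huge part, comparability together with equal size forces
-- A into the orbit of B.  This uses r + 2h = 4 log₂ n + O(1) colours, and
-- 4 ≤ r + 2/(r−1).

open import Algebra.Bundles using (CommutativeRing; Group)
import Algebra.Properties.Group as GroupProperties
open import Data.Bool using (Bool; true; false; T; not; _∧_; _∨_; if_then_else_)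
open import Data.Bool.ListAction using (any)
import Data.Bool.Properties as Boolₚ
open import Data.Empty using (⊥; ⊥-elim)
open import Data.Fin using (Fin; zero; suc; toℕ; fromℕ<; join; splitAt; finToFun; funToFin)
import Data.Fin.Properties as Finₚ
open import Data.Fin.Subset using (Subset; ∣_∣; _∈_; _⊆_)
import Data.Fin.Subset.Properties as Subsetₚ
open import Data.Integer using (+_)
import Data.Integer as ℤ
import Data.Integer.Properties as ℤₚ
open import Data.List using (List; []; _∷_; _++_; map; foldr; length; filter; allFin; cartesianProductWith)
import Data.List.Properties as Listₚ
open import Data.List.Membership.Propositional using () renaming (_∈_ to _∈ˡ_)
import Data.List.Membership.Propositional.Properties as ∈ₚ
open import Data.List.Relation.Unary.All as All using (All; []; _∷_)
import Data.List.Relation.Unary.All.Properties as Allₚ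
open import Data.List.Relation.Unary.Any as Any using (here)
import Data.List.Relation.Unary.Any.Properties as Anyₚ
open import Data.Maybe using (Maybe; just; nothing; is-just; maybe′)
open import Data.Nat as ℕ using (ℕ; zero; suc; NonZero; _∸_)
import Data.Nat.Properties as ℕₚ
open import Data.Nat.Solver using () renaming (module +-*-Solver to ℕ-Solver)
open import Data.Product using (∃; _×_; _,_; proj₁; proj₂)
open import Data.Rational using (ℚ; mkℚ; _/_; _≤_; _<_; _+_; _-_; _*_; 0ℚ; 1ℚ; ½; nonNegative; toℚᵘ)
import Data.Rational as ℚ
import Data.Rational.Properties as ℚₚ
open import Data.Rational.Solver using () renaming (module +-*-Solver to ℚ-Solver)
open import Data.Rational.Unnormalised using (mkℚᵘ; *≡*)
import Data.Rational.Unnormalised as ℚᵘ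
import Data.Rational.Unnormalised.Properties as ℚᵘₚ
open import Data.Sum using (_⊎_; inj₁; inj₂)
open import Data.Unit using (tt)
open import Data.Vec as Vec using (Vec; []; _∷_; lookup; tabulate)
import Data.Vec.Properties as Vecₚ
open import Function using (_∘_; Inverse)
open import Level using (0ℓ)
open import Relation.Binary using (Setoid; Decidable)
open import Relation.Binary.PropositionalEquality using (_≡_; _≢_; refl; sym; trans; cong; cong₂; subst; subst₂; module ≡-Reasoning)
open import Relation.Nullary using (¬_; Dec; yes; no; does; ¬?)
open import Relation.Nullary.Decidable using (map′; _×-dec_; _⊎-dec_; _→-dec_)
open import Algebra.Properties.Semiring.Exp (CommutativeRing.semiring ℚₚ.+-*-commutativeRing) using (_^_; ^-homo-*)
open import Defs


-- Finite graphs have a chromatic number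

least : {P : ℕ → Set} → (∀ k → Dec (P k)) → ∀ m → P m → ∃ λ k → P k × (∀ j → P j → k ℕ.≤ j)
least P? m pm with P? 0
... | yes p0 = 0 , p0 , λ _ _ → ℕ.z≤n
least P? zero    p0 | no ¬p0 = ⊥-elim (¬p0 p0)
least P? (suc m) pm | no ¬p0 with least (P? ∘ suc) m pm
... | k , pk , min = suc k , pk , λ { zero p0 → ⊥-elim (¬p0 p0) ; (suc j) pj → ℕ.s≤s (min j pj) }

-- Colourings live on an abstract setoid, so colourability is decided by searching the finitely many
-- functions on codes. `decode` is partial because a code need not come from a vertex.
module FiniteGraph {V : Setoid 0ℓ 0ℓ} (G : GraphOn V) (adj? : Decidable (Adj G))
  {N : ℕ} (code : Setoid.Carrier V → Fin N) (decode : Fin N → Maybe (Setoid.Carrier V))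
  (code-cong : ∀ {x y} → Setoid._≈_ V x y → code x ≡ code y)
  (decode-code : ∀ x → ∃ λ y → decode (code x) ≡ just y × Setoid._≈_ V y x) where

  open Setoid V using (Carrier; _≈_) renaming (sym to ≈-sym)

  MaybeAdj : Maybe Carrier → Maybe Carrier → Set
  MaybeAdj (just x) (just y) = Adj G x y
  MaybeAdj _        _        = ⊥

  maybeAdj? : Decidable MaybeAdj
  maybeAdj? (just x) (just y) = adj? x y
  maybeAdj? (just _) nothing  = no λ ()
  maybeAdj? nothing  _        = no λ ()

  ProperCodes : ∀ {k} → (Fin N → Fin k) → Set
  ProperCodes f = ∀ i j → MaybeAdj (decode i) (decode j) → f i ≢ f j

  properCodes? : ∀ {k} (f : Fin N → Fin k) → Dec (ProperCodes f)
  properCodes? f = Finₚ.all? λ i → Finₚ.all? λ j →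
    maybeAdj? (decode i) (decode j) →-dec ¬? (f i Finₚ.≟ f j)

  fromCodes : ∀ {k} (f : Fin N → Fin k) → ProperCodes f → Colouring G k
  fromCodes f ok = record
    { colour      = f ∘ code
    ; colour-cong = λ x≈y → cong f (code-cong x≈y)
    ; proper      = λ {x} {y} adj → ok (code x) (code y) (transport adj (decode-code x) (decode-code y))
    }
    where
    transport : ∀ {x y} → Adj G x y → (∃ λ x′ → decode (code x) ≡ just x′ × x′ ≈ x) →
                (∃ λ y′ → decode (code y) ≡ just y′ × y′ ≈ y) → MaybeAdj (decode (code x)) (decode (code y))
    transport adj (x′ , dx , x′≈x) (y′ , dy , y′≈y) =
      subst₂ MaybeAdj (sym dx) (sym dy) (Adj-resp G (≈-sym x′≈x) (≈-sym y′≈y) adj)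

  toCodes : ∀ {k} → Colouring G (suc k) → ∃ λ (f : Fin N → Fin (suc k)) → ProperCodes f
  toCodes {k} c = f , λ i j → ok (decode i) (decode j)
    where
    open Colouring c
    f : Fin N → Fin (suc k)
    -- Codes without a vertex are unconstrained and get the default colour `zero`; hence at least
    -- one colour is assumed.
    f i = maybe′ colour zero (decode i)
    ok : ∀ x y → MaybeAdj x y → maybe′ colour zero x ≢ maybe′ colour zero y
    ok (just x) (just y) adj = proper adj
    ok (just _) nothing ()
    ok nothing  _ ()

  colouring? : ∀ k → Dec (Colouring G k)
  -- With no colours there is no default: a colouring exists exactly when no code decodes.
  colouring? zero = map′
    (λ none → record
      { colour      = λ x → ⊥-elim (absurd none x)
      ; colour-cong = λ {x} _ → ⊥-elim (absurd none x)
      ; proper      = λ {x} _ → ⊥-elim (absurd none x) })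
    (λ c i → noVertex c (decode i))
    (Finₚ.all? λ i → nothing? (decode i))
    where
    nothing? : (m : Maybe Carrier) → Dec (m ≡ nothing)
    nothing? nothing  = yes refl
    nothing? (just _) = no λ ()
    absurd : (∀ i → decode i ≡ nothing) → ¬ Carrier
    absurd none x with decode-code x
    ... | _ , dx , _ with trans (sym dx) (none (code x))
    ... | ()
    noVertex : Colouring G 0 → (m : Maybe Carrier) → m ≡ nothing
    noVertex c nothing = refl
    noVertex c (just x) with Colouring.colour c x
    ... | ()
  colouring? (suc k) = map′
    (λ (e , ok) → fromCodes (finToFun e) ok)
    (λ c → let (f , ok) = toCodes c in
       funToFin f , λ i j adj e → ok i j adj
         (trans (sym (Finₚ.finToFun-funToFin f i)) (trans e (Finₚ.finToFun-funToFin f j))))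
    (Finₚ.any? λ (e : Fin (suc k ℕ.^ N)) → properCodes? (finToFun e))

  chromaticNumber : ∀ {m} → Colouring G m → ∃ λ k → IsChromaticNumber G k × k ℕ.≤ m
  chromaticNumber {m} c with least colouring? m c
  ... | k , ck , min = k , (ck , min) , min m c

-- Codes for tuples and the exact chromatic number of the compatibility graph

funToFin-cong : ∀ {m k} {f g : Fin m → Fin k} → (∀ i → f i ≡ g i) → funToFin f ≡ funToFin g
funToFin-cong {zero}  e = refl
funToFin-cong {suc m} {k} e rewrite e zero | funToFin-cong {m} {k} (e ∘ suc) = refl

subsetCode : ∀ {n} → Subset n → Fin (2 ℕ.^ n)
subsetCode p = funToFin (Inverse.from Finₚ.2↔Bool ∘ lookup p)

subsetDecode : ∀ {n} → Fin (2 ℕ.^ n) → Subset n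
subsetDecode c = tabulate (Inverse.to Finₚ.2↔Bool ∘ finToFun c)

subsetDecode-code : ∀ {n} (p : Subset n) → subsetDecode (subsetCode p) ≡ p
subsetDecode-code p = trans
  (Vecₚ.tabulate-cong λ v → trans (cong (Inverse.to Finₚ.2↔Bool) (Finₚ.finToFun-funToFin _ v))
    (Inverse.strictlyInverseˡ Finₚ.2↔Bool (lookup p v)))
  (Vecₚ.tabulate∘lookup p)

module _ {r n : ℕ} .{{_ : NonZero r}} (ω : EdgeBits n) where
  private
    module P = GPoset (shiftPoset r (graph ω))
    Tuple = HomTuple (K r) (graph ω)

  -- The two `HomTuple` conditions as nested quantifiers over finite types, decidable by exhaustion.
  IsTuple : (Fin r → Subset n) → Set
  IsTuple A = (∀ i → ∃ λ x → x ∈ A i) ×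
    (∀ i j → i ≢ j → ∀ x y → x ∈ A i → y ∈ A j → Adj (graph ω) x y)

  isTuple? : ∀ A → Dec (IsTuple A)
  isTuple? A =
    (Finₚ.all? λ i → Subsetₚ.nonempty? (A i)) ×-dec
    (Finₚ.all? λ i → Finₚ.all? λ j → ¬? (i Finₚ.≟ j) →-dec
      Finₚ.all? λ x → Finₚ.all? λ y →
        (x Subsetₚ.∈? A i) →-dec ((y Subsetₚ.∈? A j) →-dec Boolₚ.T? (isEdge ω x y)))

  toTuple : ∀ {A} → IsTuple A → Tuple
  toTuple {A} (ne , co) = record
    { part = A ; nonempty = ne ; complete = λ i≢j x∈ y∈ → co _ _ i≢j _ _ x∈ y∈ }

  tupleCode : Tuple → Fin ((2 ℕ.^ n) ℕ.^ r)
  tupleCode A = funToFin (subsetCode ∘ part A)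

  partsDecode : Fin ((2 ℕ.^ n) ℕ.^ r) → Fin r → Subset n
  partsDecode c i = subsetDecode (finToFun c i)

  tupleDecode : Fin ((2 ℕ.^ n) ℕ.^ r) → Maybe Tuple
  tupleDecode c with isTuple? (partsDecode c)
  ... | yes t = just (toTuple t)
  ... | no _  = nothing

  partsDecode-code : ∀ A i → partsDecode (tupleCode A) i ≡ part A i
  partsDecode-code A i = trans (cong subsetDecode (Finₚ.finToFun-funToFin (subsetCode ∘ part A) i))
    (subsetDecode-code (part A i))

  tupleDecode-code : ∀ A → ∃ λ B → tupleDecode (tupleCode A) ≡ just B × B P.≈ A
  tupleDecode-code A with isTuple? (partsDecode (tupleCode A))
  ... | yes t = toTuple t , refl , partsDecode-code A
  ... | no ¬t = ⊥-elim (¬t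
    ( (λ i → subst (λ p → ∃ (_∈ p)) (sym (partsDecode-code A i)) (nonempty A i))
    , (λ i j i≢j x y x∈ y∈ → complete A i≢j
        (subst (x ∈_) (partsDecode-code A i) x∈) (subst (y ∈_) (partsDecode-code A j) y∈))))

  ≈? : Decidable P._≈_
  ≈? A B = Finₚ.all? λ i → Vecₚ.≡-dec Boolₚ._≟_ (part A i) (part B i)

  ⊑? : Decidable P._⊑_
  ⊑? A B = Finₚ.all? λ i → part A i Subsetₚ.⊆? part B i

  strongAdj? : Decidable (StrongAdj (shiftPoset r (graph ω)))
  strongAdj? A B =
    (Finₚ.any? λ g → ¬? (g Finₚ.≟ _) ×-dec (⊑? A (g P.· B) ⊎-dec ⊑? (g P.· B) A)) ×-dec
    ¬? (Finₚ.any? λ g → ≈? B (g P.· A))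

  -- The event asks for the chromatic number itself as witness, so an explicit colouring does not
  -- suffice; the finite search turns its number of colours into a bound on the exact value.
  strongChromaticNumber : ∀ {m} → Colouring (strongCompatibilityGraph (shiftPoset r (graph ω))) m →
    ∃ λ k → IsChromaticNumber (strongCompatibilityGraph (shiftPoset r (graph ω))) k × k ℕ.≤ m
  strongChromaticNumber = FiniteGraph.chromaticNumber _ strongAdj? tupleCode tupleDecode
    (λ A≈B → funToFin-cong (cong subsetCode ∘ A≈B)) tupleDecode-code

-- Partial labellings of the vertices

-- A family of pairwise disjoint vertex classes; `nothing` marks the vertices outside all of them.
-- The vector form lets recursions follow `EdgeBits`.
Labelling : ℕ → ℕ → Set
Labelling r n = Vec (Maybe (Fin r)) n

hasLabel : ∀ {r} → Fin r → Maybe (Fin r) → Bool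
hasLabel i nothing  = false
hasLabel i (just j) = does (i Finₚ.≟ j)

clash : ∀ {r} → Maybe (Fin r) → Maybe (Fin r) → Bool
clash (just i) (just j) = not (does (i Finₚ.≟ j))
clash _        _        = false

classSize : ∀ {r n} → Fin r → Labelling r n → ℕ
classSize i ℓ = ∣ Vec.map (hasLabel i) ℓ ∣

size : ∀ {r n} → Labelling r n → ℕ
size ℓ = ∣ Vec.map is-just ℓ ∣

degree : ∀ {r n} → Maybe (Fin r) → Labelling r n → ℕ
degree a ℓ = ∣ Vec.map (clash a) ℓ ∣

-- The number of edges prescribed when all pairs across classes must be adjacent, counted row by row
-- as in `EdgeBits`.
crossPairs : ∀ {r n} → Labelling r n → ℕ
crossPairs []      = 0
crossPairs (a ∷ ℓ) = degree a ℓ ℕ.+ crossPairs ℓ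

degree-nothing : ∀ {r n} (ℓ : Labelling r n) → degree nothing ℓ ≡ 0
degree-nothing []             = refl
degree-nothing (nothing ∷ ℓ)  = degree-nothing ℓ
degree-nothing (just _ ∷ ℓ)   = degree-nothing ℓ

degree+classSize : ∀ {r n} i (ℓ : Labelling r n) → degree (just i) ℓ ℕ.+ classSize i ℓ ≡ size ℓ
degree+classSize i []            = refl
degree+classSize i (nothing ∷ ℓ) = degree+classSize i ℓ
degree+classSize i (just j ∷ ℓ) with i Finₚ.≟ j
... | yes _ = trans (ℕₚ.+-suc _ _) (cong suc (degree+classSize i ℓ))
... | no  _ = cong suc (degree+classSize i ℓ)

-- For `f` the class size this is the sum of the squares of the class sizes, that is, the number of
-- ordered pairs with equal labels.
sumLabels : ∀ {r n} → (Fin r → ℕ) → Labelling r n → ℕ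
sumLabels f []            = 0
sumLabels f (nothing ∷ ℓ) = sumLabels f ℓ
sumLabels f (just i ∷ ℓ)  = f i ℕ.+ sumLabels f ℓ

sumLabels-≤ : ∀ {r n h} (f : Fin r → ℕ) → (∀ i → f i ℕ.≤ h) → (ℓ : Labelling r n) →
              sumLabels f ℓ ℕ.≤ size ℓ ℕ.* h
sumLabels-≤ f f≤h []            = ℕ.z≤n
sumLabels-≤ f f≤h (nothing ∷ ℓ) = sumLabels-≤ f f≤h ℓ
sumLabels-≤ f f≤h (just i ∷ ℓ)  = ℕₚ.+-mono-≤ (f≤h i) (sumLabels-≤ f f≤h ℓ)

-- Extending class `a` by one vertex adds one to the term of each vertex of `ℓ′` in that class. `ℓ`
-- and `ℓ′` coincide in the application but stay separate here so that the induction runs on `ℓ′`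
-- alone.
sumLabels-just : ∀ {r n m} a (ℓ : Labelling r n) (ℓ′ : Labelling r m) →
  sumLabels (λ i → classSize i (just a ∷ ℓ)) ℓ′ ≡ classSize a ℓ′ ℕ.+ sumLabels (λ i → classSize i ℓ) ℓ′
sumLabels-just a ℓ []             = refl
sumLabels-just a ℓ (nothing ∷ ℓ′) = sumLabels-just a ℓ ℓ′
sumLabels-just a ℓ (just b ∷ ℓ′) with sumLabels-just a ℓ ℓ′ | b Finₚ.≟ a | a Finₚ.≟ b
... | ih | yes _   | yes _   = cong suc (trans (cong (classSize b ℓ ℕ.+_) ih)
  (solve 3 (λ x y z → x :+ (y :+ z) := y :+ (x :+ z)) refl (classSize b ℓ) (classSize a ℓ′) _))
  where open ℕ-Solver
... | ih | no _    | no _    = trans (cong (classSize b ℓ ℕ.+_) ih)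
  (solve 3 (λ x y z → x :+ (y :+ z) := y :+ (x :+ z)) refl (classSize b ℓ) (classSize a ℓ′) _)
  where open ℕ-Solver
... | ih | yes b≡a | no a≢b  = ⊥-elim (a≢b (sym b≡a))
... | ih | no b≢a  | yes a≡b = ⊥-elim (b≢a (sym a≡b))

-- Counts ordered pairs of labelled vertices, by whether their labels differ.
crossPairs-identity : ∀ {r n} (ℓ : Labelling r n) →
  2 ℕ.* crossPairs ℓ ℕ.+ sumLabels (λ i → classSize i ℓ) ℓ ≡ size ℓ ℕ.* size ℓ
crossPairs-identity [] = refl
crossPairs-identity (nothing ∷ ℓ) rewrite degree-nothing ℓ = crossPairs-identity ℓ
crossPairs-identity (just a ∷ ℓ) with a Finₚ.≟ a
... | no a≢a = ⊥-elim (a≢a refl)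
... | yes _  = begin
  2 ℕ.* (d ℕ.+ c) ℕ.+ (suc k ℕ.+ sumLabels (λ i → classSize i (just a ∷ ℓ)) ℓ)
    ≡⟨ cong (λ s → 2 ℕ.* (d ℕ.+ c) ℕ.+ (suc k ℕ.+ s)) (sumLabels-just a ℓ ℓ) ⟩
  2 ℕ.* (d ℕ.+ c) ℕ.+ (suc k ℕ.+ (k ℕ.+ s))
    ≡⟨ solve 4 (λ d c k s → con 2 :* (d :+ c) :+ (con 1 :+ k :+ (k :+ s)) :=
         con 1 :+ con 2 :* (d :+ k) :+ (con 2 :* c :+ s)) refl d c k s ⟩
  1 ℕ.+ 2 ℕ.* (d ℕ.+ k) ℕ.+ (2 ℕ.* c ℕ.+ s)
    ≡⟨ cong₂ (λ u v → 1 ℕ.+ 2 ℕ.* u ℕ.+ v) (degree+classSize a ℓ) (crossPairs-identity ℓ) ⟩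
  1 ℕ.+ 2 ℕ.* m ℕ.+ m ℕ.* m
    ≡⟨ solve 1 (λ m → con 1 :+ con 2 :* m :+ m :* m := (con 1 :+ m) :* (con 1 :+ m)) refl m ⟩
  suc m ℕ.* suc m ∎
  where
  open ≡-Reasoning
  open ℕ-Solver
  d c k s m : ℕ
  d = degree (just a) ℓ
  c = crossPairs ℓ
  k = classSize a ℓ
  s = sumLabels (λ i → classSize i ℓ) ℓ
  m = size ℓ

-- Of the `4h²` ordered pairs of labelled vertices at most `2h * h` have equal labels, since each
-- vertex sees at most `h` members of its class. The remaining ones count every cross pair twice.
h²≤crossPairs : ∀ {r n} h (ℓ : Labelling r n) → size ℓ ≡ 2 ℕ.* h → (∀ i → classSize i ℓ ℕ.≤ h) →
                h ℕ.* h ℕ.≤ crossPairs ℓ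
h²≤crossPairs h ℓ size≡ small = ℕₚ.*-cancelˡ-≤ 2 (ℕₚ.+-cancelʳ-≤ (2 ℕ.* h ℕ.* h) _ _ (begin
  2 ℕ.* (h ℕ.* h) ℕ.+ 2 ℕ.* h ℕ.* h
    ≡⟨ solve 1 (λ h → con 2 :* (h :* h) :+ con 2 :* h :* h := (con 2 :* h) :* (con 2 :* h)) refl h ⟩
  (2 ℕ.* h) ℕ.* (2 ℕ.* h)                                     ≡⟨ cong (λ m → m ℕ.* m) size≡ ⟨
  size ℓ ℕ.* size ℓ                                           ≡⟨ crossPairs-identity ℓ ⟨
  2 ℕ.* crossPairs ℓ ℕ.+ sumLabels (λ i → classSize i ℓ) ℓ    ≤⟨ ℕₚ.+-monoʳ-≤ (2 ℕ.* crossPairs ℓ) (sumLabels-≤ _ small ℓ) ⟩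
  2 ℕ.* crossPairs ℓ ℕ.+ size ℓ ℕ.* h                         ≡⟨ cong (λ m → 2 ℕ.* crossPairs ℓ ℕ.+ m ℕ.* h) size≡ ⟩
  2 ℕ.* crossPairs ℓ ℕ.+ 2 ℕ.* h ℕ.* h                        ∎))
  where
  open ℕₚ.≤-Reasoning
  open ℕ-Solver

-- Enumeration of labellings with a prescribed number of labelled vertices

labellings : ∀ r n → ℕ → List (Labelling r n)
labellings r zero    zero    = [] ∷ []
labellings r zero    (suc m) = []
labellings r (suc n) zero    = map (nothing ∷_) (labellings r n 0)
labellings r (suc n) (suc m) = map (nothing ∷_) (labellings r n (suc m)) ++
  cartesianProductWith (λ i ℓ → just i ∷ ℓ) (allFin r) (labellings r n m)

∈-labellings : ∀ {r n} (ℓ : Labelling r n) → ℓ ∈ˡ labellings r n (size ℓ)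
∈-labellings []            = here refl
∈-labellings (just i ∷ ℓ)  = ∈ₚ.∈-++⁺ʳ _ (∈ₚ.∈-cartesianProductWith⁺ _ (∈ₚ.∈-allFin i) (∈-labellings ℓ))
-- `labellings` splits on the number of labelled vertices even when the head is unlabelled, so that
-- number is generalised to `m` first.
∈-labellings (nothing ∷ ℓ) = skip (size ℓ) (∈-labellings ℓ)
  where
  skip : ∀ m → ℓ ∈ˡ labellings _ _ m → (nothing ∷ ℓ) ∈ˡ labellings _ _ m
  skip zero    ∈ = ∈ₚ.∈-map⁺ (nothing ∷_) ∈
  skip (suc m) ∈ = ∈ₚ.∈-++⁺ˡ (∈ₚ.∈-map⁺ (nothing ∷_) ∈)

labellings-size : ∀ r n m → All (λ ℓ → size ℓ ≡ m) (labellings r n m)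
labellings-size r zero    zero    = refl ∷ []
labellings-size r zero    (suc m) = []
labellings-size r (suc n) zero    = Allₚ.map⁺ (labellings-size r n 0)
labellings-size r (suc n) (suc m) = Allₚ.++⁺ (Allₚ.map⁺ (labellings-size r n (suc m))) (extend (allFin r))
  where
  extend : ∀ is → All (λ ℓ → size ℓ ≡ suc m) (cartesianProductWith (λ i ℓ → just i ∷ ℓ) is (labellings r n m))
  extend []       = []
  extend (i ∷ is) = Allₚ.++⁺ (Allₚ.map⁺ (All.map (cong suc) (labellings-size r n m))) (extend is)

length-cartesianProductWith : ∀ {A B C : Set} (f : A → B → C) xs ys →
  length (cartesianProductWith f xs ys) ≡ length xs ℕ.* length ys
length-cartesianProductWith f []       ys = refl
length-cartesianProductWith f (x ∷ xs) ys = trans (Listₚ.length-++ (map (f x) ys))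
  (cong₂ ℕ._+_ (Listₚ.length-map (f x) ys) (length-cartesianProductWith f xs ys))

-- Each of the `m` labelled vertices is a choice of a vertex and a label. In the induction,
-- labellings that skip or use the first vertex contribute at most `r n x` and `r x` with
-- `x = (r n)^m`, together `r (n + 1) x`.
length-labellings : ∀ r n m → length (labellings r n m) ℕ.≤ (r ℕ.* n) ℕ.^ m
length-labellings r zero    zero    = ℕₚ.≤-refl
length-labellings r zero    (suc m) = ℕ.z≤n
length-labellings r (suc n) zero    = subst (ℕ._≤ 1) (sym (Listₚ.length-map _ (labellings r n 0))) (length-labellings r n 0)
length-labellings r (suc n) (suc m) = begin
  length (map (nothing ∷_) (labellings r n (suc m)) ++ cartesianProductWith (λ i ℓ → just i ∷ ℓ) (allFin r) (labellings r n m))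
    ≡⟨ Listₚ.length-++ (map (nothing ∷_) (labellings r n (suc m))) ⟩
  length (map (Vec._∷_ nothing) (labellings r n (suc m))) ℕ.+ length (cartesianProductWith (λ i ℓ → just i ∷ ℓ) (allFin r) (labellings r n m))
    ≡⟨ cong₂ ℕ._+_ (Listₚ.length-map _ (labellings r n (suc m)))
        (trans (length-cartesianProductWith _ (allFin r) (labellings r n m))
               (cong (ℕ._* length (labellings r n m)) (Listₚ.length-tabulate {n = r} _))) ⟩
  length (labellings r n (suc m)) ℕ.+ r ℕ.* length (labellings r n m)
    ≤⟨ ℕₚ.+-mono-≤ (length-labellings r n (suc m)) (ℕₚ.*-monoʳ-≤ r (length-labellings r n m)) ⟩
  (r ℕ.* n) ℕ.* (r ℕ.* n) ℕ.^ m ℕ.+ r ℕ.* (r ℕ.* n) ℕ.^ m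
    ≡⟨ solve 3 (λ r n x → r :* n :* x :+ r :* x := r :* (con 1 :+ n) :* x) refl r n ((r ℕ.* n) ℕ.^ m) ⟩
  (r ℕ.* suc n) ℕ.* (r ℕ.* n) ℕ.^ m
    ≤⟨ ℕₚ.*-monoʳ-≤ (r ℕ.* suc n) (ℕₚ.^-monoˡ-≤ m (ℕₚ.*-monoʳ-≤ r (ℕₚ.n≤1+n n))) ⟩
  (r ℕ.* suc n) ℕ.* (r ℕ.* suc n) ℕ.^ m ∎
  where
  open ℕₚ.≤-Reasoning
  open ℕ-Solver

-- Compatibility of a graph with a labelling

compatibleRow : ∀ {r n} → Maybe (Fin r) → Vec Bool n → Labelling r n → Bool
compatibleRow a []      []      = true
compatibleRow a (b ∷ v) (c ∷ ℓ) = (not (clash a c) ∨ b) ∧ compatibleRow a v ℓ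

compatible : ∀ {r n} → EdgeBits n → Labelling r n → Bool
compatible []      []      = true
compatible (v ∷ ω) (a ∷ ℓ) = compatibleRow a v ℓ ∧ compatible ω ℓ

-- Finite sums and independence of edges

∑ : ∀ {A : Set} → List A → (A → ℚ) → ℚ
∑ xs f = foldr _+_ 0ℚ (map f xs)

∑-cong : ∀ {A : Set} (xs : List A) {f g} → (∀ x → f x ≡ g x) → ∑ xs f ≡ ∑ xs g
∑-cong []       e = refl
∑-cong (x ∷ xs) e = cong₂ _+_ (e x) (∑-cong xs e)

∑-mono : ∀ {A : Set} (xs : List A) {f g} → (∀ x → f x ≤ g x) → ∑ xs f ≤ ∑ xs g
∑-mono []       e = ℚₚ.≤-refl
∑-mono (x ∷ xs) e = ℚₚ.+-mono-≤ (e x) (∑-mono xs e)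

∑-+ : ∀ {A : Set} (xs : List A) f g → ∑ xs (λ x → f x + g x) ≡ ∑ xs f + ∑ xs g
∑-+ []       f g = refl
∑-+ (x ∷ xs) f g = trans (cong (λ s → f x + g x + s) (∑-+ xs f g))
  (solve 4 (λ a b s t → a :+ b :+ (s :+ t) := (a :+ s) :+ (b :+ t)) refl (f x) (g x) (∑ xs f) (∑ xs g))
  where open ℚ-Solver

∑-++ : ∀ {A : Set} (xs ys : List A) f → ∑ (xs ++ ys) f ≡ ∑ xs f + ∑ ys f
∑-++ []       ys f = sym (ℚₚ.+-identityˡ _)
∑-++ (x ∷ xs) ys f = trans (cong (_+_ (f x)) (∑-++ xs ys f)) (sym (ℚₚ.+-assoc (f x) _ _))

∑-map-scale : ∀ {A B : Set} (c : B → A) (ys : List B) f g k → (∀ y → f (c y) ≡ k * g y) → ∑ (map c ys) f ≡ k * ∑ ys g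
∑-map-scale c []       f g k e = sym (ℚₚ.*-zeroʳ k)
∑-map-scale c (y ∷ ys) f g k e = trans (cong₂ _+_ (e y) (∑-map-scale c ys f g k e))
  (sym (ℚₚ.*-distribˡ-+ k (g y) (∑ ys g)))

-- The source of independence: the weight of a graph and the indicator of compatibility both factor
-- along `cartesianProductWith`, by which the sample space is built.
∑-product : ∀ {A B C : Set} (c : A → B → C) (xs : List A) (ys : List B) f g h →
  (∀ x y → f (c x y) ≡ g x * h y) → ∑ (cartesianProductWith c xs ys) f ≡ ∑ xs g * ∑ ys h
∑-product c []       ys f g h e = sym (ℚₚ.*-zeroˡ (∑ ys h))
∑-product c (x ∷ xs) ys f g h e = trans (∑-++ (map (c x) ys) _ f)
  (trans (cong₂ _+_ (∑-map-scale (c x) ys f h (g x) (e x)) (∑-product c xs ys f g h e))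
         (sym (ℚₚ.*-distribʳ-+ (∑ ys h) (g x) (∑ xs g))))

if-∧ : ∀ a b x y → (if a ∧ b then x * y else 0ℚ) ≡ (if a then x else 0ℚ) * (if b then y else 0ℚ)
if-∧ true  true  x y = refl
if-∧ true  false x y = sym (ℚₚ.*-zeroʳ x)
if-∧ false b     x y = sym (ℚₚ.*-zeroˡ (if b then y else 0ℚ))

ℙ-compatibleRow : ∀ {r n} p a (ℓ : Labelling r n) →
  ∑ (allBits n) (λ v → if compatibleRow a v ℓ then bitsWeight p v else 0ℚ) ≡ p ^ degree a ℓ
ℙ-compatibleRow p a [] = refl
ℙ-compatibleRow {n = suc n} p a (c ∷ ℓ) = trans
  (∑-product _∷_ (true ∷ false ∷ []) (allBits n) _ bit row factor) (entry (clash a c) refl)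
  where
  weight₁ : Bool → ℚ
  weight₁ true  = p
  weight₁ false = 1ℚ - p
  bit : Bool → ℚ
  bit b = if not (clash a c) ∨ b then weight₁ b else 0ℚ
  row : Vec Bool n → ℚ
  row v = if compatibleRow a v ℓ then bitsWeight p v else 0ℚ
  factor : ∀ b v → (if compatibleRow a (b ∷ v) (c ∷ ℓ) then bitsWeight p (b ∷ v) else 0ℚ) ≡ bit b * row v
  factor true  v = if-∧ (not (clash a c) ∨ true) (compatibleRow a v ℓ) p (bitsWeight p v)
  factor false v = if-∧ (not (clash a c) ∨ false) (compatibleRow a v ℓ) (1ℚ - p) (bitsWeight p v)
  open ℚ-Solver
  -- A clashing pair forces its bit to be true and contributes `p`; any other pair leaves the bit
  -- free and contributes `p + (1 - p) = 1`.
  entry : ∀ x → clash a c ≡ x → (bit true + (bit false + 0ℚ)) * ∑ (allBits n) row ≡ p ^ degree a (c ∷ ℓ)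
  entry true  e rewrite e = cong₂ _*_ (solve 1 (λ p → p :+ con 0ℚ := p) refl p) (ℙ-compatibleRow p a ℓ)
  entry false e rewrite e = trans
    (cong₂ _*_ (solve 1 (λ p → p :+ (con 1ℚ :- p :+ con 0ℚ) := con 1ℚ) refl p) (ℙ-compatibleRow p a ℓ))
    (ℚₚ.*-identityˡ _)

-- Rows are independent, and each contributes `p` to the power of its number of clashes, so the
-- exponents add up to the number of prescribed edges.
ℙ-compatible : ∀ {r n} p (ℓ : Labelling r n) → ℙ p (λ ω → compatible ω ℓ) ≡ p ^ crossPairs ℓ
ℙ-compatible p [] = refl
ℙ-compatible {n = suc n} p (a ∷ ℓ) = trans
  (∑-product _∷_ (allBits n) (allEdgeBits n) _ _ _
    (λ v ω → if-∧ (compatibleRow a v ℓ) (compatible ω ℓ) (bitsWeight p v) (weight p ω)))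
  (trans (cong₂ _*_ (ℙ-compatibleRow p a ℓ) (ℙ-compatible p ℓ))
         (sym (^-homo-* p (degree a ℓ) (crossPairs ℓ))))

compatibleRow-nothing : ∀ {r n} (v : Vec Bool n) (ℓ : Labelling r n) → compatibleRow nothing v ℓ ≡ true
compatibleRow-nothing []      []      = refl
compatibleRow-nothing (b ∷ v) (c ∷ ℓ) = compatibleRow-nothing v ℓ

compatible-unlabelled : ∀ {n} (ω : EdgeBits n) → compatible {0} ω (Vec.replicate n nothing) ≡ true
compatible-unlabelled []      = refl
compatible-unlabelled (v ∷ ω) = cong₂ _∧_ (compatibleRow-nothing v (Vec.replicate _ nothing)) (compatible-unlabelled ω)

crossPairs-unlabelled : ∀ n → crossPairs {0} (Vec.replicate n nothing) ≡ 0
crossPairs-unlabelled zero    = refl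
crossPairs-unlabelled (suc n) = cong₂ ℕ._+_ (degree-nothing (Vec.replicate n nothing)) (crossPairs-unlabelled n)

-- The labelling without labelled vertices prescribes no edge, so every graph is compatible with it
-- and `ℙ-compatible` gives `p ^ 0`.
ℙ-total : ∀ p n → ∑ (allEdgeBits n) (weight p) ≡ 1ℚ
ℙ-total p n = trans
  (∑-cong (allEdgeBits n) (λ ω → cong (if_then weight p ω else 0ℚ) (sym (compatible-unlabelled ω))))
  (trans (ℙ-compatible {0} p (Vec.replicate n nothing)) (cong (p ^_) (crossPairs-unlabelled n)))

ℙ-not : ∀ p {n} (B : EdgeBits n → Bool) → ℙ p (not ∘ B) ≡ 1ℚ - ℙ p B
ℙ-not p {n} B = begin
  ℙ p (not ∘ B)                      ≡⟨ solve 2 (λ a b → a := (a :+ b) :- b) refl (ℙ p (not ∘ B)) (ℙ p B) ⟩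
  (ℙ p (not ∘ B) + ℙ p B) - ℙ p B    ≡⟨ cong (_- ℙ p B) (∑-+ (allEdgeBits n) _ _) ⟨
  ∑ (allEdgeBits n) _ - ℙ p B        ≡⟨ cong (_- ℙ p B) (∑-cong (allEdgeBits n) (λ ω → split (B ω) (weight p ω))) ⟩
  ∑ (allEdgeBits n) (weight p) - ℙ p B ≡⟨ cong (_- ℙ p B) (ℙ-total p n) ⟩
  1ℚ - ℙ p B                         ∎
  where
  open ≡-Reasoning
  open ℚ-Solver
  split : ∀ b w → (if not b then w else 0ℚ) + (if b then w else 0ℚ) ≡ w
  split true  w = ℚₚ.+-identityˡ w
  split false w = ℚₚ.+-identityʳ w

*-nonNeg : ∀ {p q} → 0ℚ ≤ p → 0ℚ ≤ q → 0ℚ ≤ p * q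
*-nonNeg {p} {q} 0≤p 0≤q = subst (_≤ p * q) (ℚₚ.*-zeroʳ p) (ℚₚ.*-monoˡ-≤-nonNeg p {{nonNegative 0≤p}} 0≤q)

bitsWeight-nonNeg : ∀ {p n} → 0ℚ ≤ p → 0ℚ ≤ 1ℚ - p → (v : Vec Bool n) → 0ℚ ≤ bitsWeight p v
bitsWeight-nonNeg 0≤p 0≤q []          = ℚₚ.nonNegative⁻¹ 1ℚ
bitsWeight-nonNeg 0≤p 0≤q (true ∷ v)  = *-nonNeg 0≤p (bitsWeight-nonNeg 0≤p 0≤q v)
bitsWeight-nonNeg 0≤p 0≤q (false ∷ v) = *-nonNeg 0≤q (bitsWeight-nonNeg 0≤p 0≤q v)

weight-nonNeg : ∀ {p n} → 0ℚ ≤ p → 0ℚ ≤ 1ℚ - p → (ω : EdgeBits n) → 0ℚ ≤ weight p ω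
weight-nonNeg 0≤p 0≤q []      = ℚₚ.nonNegative⁻¹ 1ℚ
weight-nonNeg 0≤p 0≤q (v ∷ ω) = *-nonNeg (bitsWeight-nonNeg 0≤p 0≤q v) (weight-nonNeg 0≤p 0≤q ω)

ℙ-∨ : ∀ {p n} → 0ℚ ≤ p → 0ℚ ≤ 1ℚ - p → (B C : EdgeBits n → Bool) →
      ℙ p (λ ω → B ω ∨ C ω) ≤ ℙ p B + ℙ p C
ℙ-∨ {p} {n} 0≤p 0≤q B C = ℚₚ.≤-trans
  (∑-mono (allEdgeBits n) (λ ω → pointwise (B ω) (C ω) (weight-nonNeg 0≤p 0≤q ω)))
  (ℚₚ.≤-reflexive (∑-+ (allEdgeBits n) _ _))
  where
  pointwise : ∀ b c {w} → 0ℚ ≤ w →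
    (if b ∨ c then w else 0ℚ) ≤ (if b then w else 0ℚ) + (if c then w else 0ℚ)
  pointwise true  true  {w} 0≤w = subst (_≤ w + w) (ℚₚ.+-identityʳ w) (ℚₚ.+-monoʳ-≤ w 0≤w)
  pointwise true  false {w} 0≤w = ℚₚ.≤-reflexive (sym (ℚₚ.+-identityʳ w))
  pointwise false c     {w} 0≤w = ℚₚ.≤-reflexive (sym (ℚₚ.+-identityˡ _))

-- Natural numbers as rationals, the union bound over a list, powers of one half

fromNat : ℕ → ℚ
fromNat k = + k / 1

fromNat-+ : ∀ m k → fromNat (m ℕ.+ k) ≡ fromNat m + fromNat k
fromNat-+ m k = ℚₚ.toℚᵘ-injective (begin
  toℚᵘ (fromNat (m ℕ.+ k))               ≈⟨ ℚₚ.toℚᵘ-fromℚᵘ (mkℚᵘ (+ (m ℕ.+ k)) 0) ⟩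
  mkℚᵘ (+ (m ℕ.+ k)) 0                   ≈⟨ *≡* (cong (ℤ._* + 1)
      (trans (ℤₚ.pos-+ m k) (sym (cong₂ ℤ._+_ (ℤₚ.*-identityʳ (+ m)) (ℤₚ.*-identityʳ (+ k)))))) ⟩
  mkℚᵘ (+ m) 0 ℚᵘ.+ mkℚᵘ (+ k) 0         ≈⟨ ℚᵘₚ.+-cong (ℚₚ.toℚᵘ-fromℚᵘ (mkℚᵘ (+ m) 0)) (ℚₚ.toℚᵘ-fromℚᵘ (mkℚᵘ (+ k) 0)) ⟨
  toℚᵘ (fromNat m) ℚᵘ.+ toℚᵘ (fromNat k) ≈⟨ ℚₚ.toℚᵘ-homo-+ (fromNat m) (fromNat k) ⟨
  toℚᵘ (fromNat m + fromNat k)           ∎)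
  where open ℚᵘₚ.≃-Reasoning

fromNat-* : ∀ m k → fromNat (m ℕ.* k) ≡ fromNat m * fromNat k
fromNat-* zero    k = sym (ℚₚ.*-zeroˡ (fromNat k))
fromNat-* (suc m) k = begin
  fromNat (k ℕ.+ m ℕ.* k)             ≡⟨ fromNat-+ k (m ℕ.* k) ⟩
  fromNat k + fromNat (m ℕ.* k)       ≡⟨ cong (_+_ (fromNat k)) (fromNat-* m k) ⟩
  fromNat k + fromNat m * fromNat k   ≡⟨ solve 2 (λ m k → k :+ m :* k := (con 1ℚ :+ m) :* k) refl (fromNat m) (fromNat k) ⟩
  (1ℚ + fromNat m) * fromNat k        ≡⟨ cong (_* fromNat k) (fromNat-+ 1 m) ⟨
  fromNat (suc m) * fromNat k         ∎
  where
  open ≡-Reasoning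
  open ℚ-Solver

fromNat-nonNeg : ∀ k → 0ℚ ≤ fromNat k
fromNat-nonNeg k = ℚₚ.nonNegative⁻¹ (fromNat k) {{ℚₚ.normalize-nonNeg k 1}}

fromNat-mono : ∀ {m k} → m ℕ.≤ k → fromNat m ≤ fromNat k
fromNat-mono {m} {k} m≤k = subst₂ _≤_ (ℚₚ.+-identityʳ (fromNat m))
  (trans (sym (fromNat-+ m (k ℕ.∸ m))) (cong fromNat (ℕₚ.m+[n∸m]≡n m≤k)))
  (ℚₚ.+-monoʳ-≤ (fromNat m) (fromNat-nonNeg (k ℕ.∸ m)))

ℙ-any : ∀ {A : Set} {p n b} → 0ℚ ≤ p → 0ℚ ≤ 1ℚ - p → (B : EdgeBits n → A → Bool) (xs : List A) →
  All (λ x → ℙ p (λ ω → B ω x) ≤ b) xs → ℙ p (λ ω → any (B ω) xs) ≤ fromNat (length xs) * b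
ℙ-any {n = n} {b} 0≤p 0≤q B [] [] =
  subst₂ _≤_ (sym (zeros (allEdgeBits n))) (sym (ℚₚ.*-zeroˡ b)) ℚₚ.≤-refl
  where
  zeros : ∀ {A : Set} (xs : List A) → ∑ xs (λ _ → 0ℚ) ≡ 0ℚ
  zeros []       = refl
  zeros (_ ∷ xs) = trans (ℚₚ.+-identityˡ _) (zeros xs)
ℙ-any {p = p} {b = b} 0≤p 0≤q B (x ∷ xs) (px ∷ pxs) = begin
  ℙ p (λ ω → B ω x ∨ any (B ω) xs)                  ≤⟨ ℙ-∨ 0≤p 0≤q (λ ω → B ω x) (λ ω → any (B ω) xs) ⟩
  ℙ p (λ ω → B ω x) + ℙ p (λ ω → any (B ω) xs)      ≤⟨ ℚₚ.+-mono-≤ px (ℙ-any 0≤p 0≤q B xs pxs) ⟩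
  b + fromNat (length xs) * b                       ≡⟨ solve 2 (λ m b → b :+ m :* b := (con 1ℚ :+ m) :* b) refl (fromNat (length xs)) b ⟩
  (1ℚ + fromNat (length xs)) * b                    ≡⟨ cong (_* b) (fromNat-+ 1 (length xs)) ⟨
  fromNat (suc (length xs)) * b                     ∎
  where
  open ℚₚ.≤-Reasoning
  open ℚ-Solver

½^-nonNeg : ∀ k → 0ℚ ≤ ½ ^ k
½^-nonNeg zero    = ℚₚ.nonNegative⁻¹ 1ℚ
½^-nonNeg (suc k) = *-nonNeg (ℚₚ.nonNegative⁻¹ ½) (½^-nonNeg k)

½^*2^ : ∀ k → ½ ^ k * fromNat (2 ℕ.^ k) ≡ 1ℚ
½^*2^ zero    = refl
½^*2^ (suc k) = begin
  ½ * ½ ^ k * fromNat (2 ℕ.* 2 ℕ.^ k)         ≡⟨ cong (½ * ½ ^ k *_) (fromNat-* 2 (2 ℕ.^ k)) ⟩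
  ½ * ½ ^ k * (fromNat 2 * fromNat (2 ℕ.^ k)) ≡⟨ solve 2 (λ a b → con ½ :* a :* (con (fromNat 2) :* b) := a :* b) refl (½ ^ k) (fromNat (2 ℕ.^ k)) ⟩
  ½ ^ k * fromNat (2 ℕ.^ k)                   ≡⟨ ½^*2^ k ⟩
  1ℚ                                          ∎
  where
  open ≡-Reasoning
  open ℚ-Solver

-- Multiplying the hypothesis by `½ ^ c * ½ ^ t` cancels the powers of two. This carries the count
-- of configurations, an inequality of naturals, over to probabilities.
scale-½^ : ∀ a c t → a ℕ.* 2 ℕ.^ t ℕ.≤ 2 ℕ.^ c → fromNat a * ½ ^ c ≤ ½ ^ t
scale-½^ a c t a2ᵗ≤2ᶜ = subst₂ _≤_ lhs rhs
  (ℚₚ.*-monoˡ-≤-nonNeg (½ ^ c * ½ ^ t) {{nonNegative (*-nonNeg (½^-nonNeg c) (½^-nonNeg t))}} (fromNat-mono a2ᵗ≤2ᶜ))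
  where
  open ℚ-Solver
  lhs : ½ ^ c * ½ ^ t * fromNat (a ℕ.* 2 ℕ.^ t) ≡ fromNat a * ½ ^ c
  lhs = trans (cong (½ ^ c * ½ ^ t *_) (fromNat-* a (2 ℕ.^ t)))
    (trans (solve 4 (λ c t a u → c :* t :* (a :* u) := a :* c :* (t :* u)) refl (½ ^ c) (½ ^ t) (fromNat a) (fromNat (2 ℕ.^ t)))
      (trans (cong (fromNat a * ½ ^ c *_) (½^*2^ t)) (ℚₚ.*-identityʳ _)))
  rhs : ½ ^ c * ½ ^ t * fromNat (2 ℕ.^ c) ≡ ½ ^ t
  rhs = trans (solve 3 (λ c t u → c :* t :* u := t :* (c :* u)) refl (½ ^ c) (½ ^ t) (fromNat (2 ℕ.^ c)))
    (trans (cong (½ ^ t *_) (½^*2^ c)) (ℚₚ.*-identityʳ _))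

½^-antimono : ∀ {a b} → a ℕ.≤ b → ½ ^ b ≤ ½ ^ a
½^-antimono {a} {b} a≤b = subst (_≤ ½ ^ a) (ℚₚ.*-identityˡ _)
  (scale-½^ 1 b a (ℕₚ.≤-trans (ℕₚ.≤-reflexive (ℕₚ.*-identityˡ _)) (ℕₚ.^-monoʳ-≤ 2 a≤b)))

-- First moment bound for bad graphs

SmallClasses : ∀ {r n} → ℕ → Labelling r n → Set
SmallClasses h ℓ = ∀ i → classSize i ℓ ℕ.≤ h

smallClasses? : ∀ {r n} h (ℓ : Labelling r n) → Dec (SmallClasses h ℓ)
smallClasses? h ℓ = Finₚ.all? λ i → classSize i ℓ ℕₚ.≤? h

balanced : ∀ r n → ℕ → List (Labelling r n)
balanced r n h = filter (smallClasses? h) (labellings r n (2 ℕ.* h))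

isBad : ∀ r {n} → ℕ → EdgeBits n → Bool
isBad r {n} h ω = any (compatible ω) (balanced r n h)

-- There are at most `(r n)^(2h)` balanced labellings, and each is compatible with probability at
-- most `½ ^ (h * h)` because it prescribes at least `h²` edges.
ℙ-isBad : ∀ r n h t → (r ℕ.* n) ℕ.^ (2 ℕ.* h) ℕ.* 2 ℕ.^ t ℕ.≤ 2 ℕ.^ (h ℕ.* h) →
          ℙ ½ (isBad r {n} h) ≤ ½ ^ t
ℙ-isBad r n h t enough = ℚₚ.≤-trans
  (ℙ-any (ℚₚ.nonNegative⁻¹ ½) (ℚₚ.nonNegative⁻¹ (1ℚ - ½)) compatible (balanced r n h)
    (All.zipWith (λ {ℓ} (size≡ , small) → subst (_≤ ½ ^ (h ℕ.* h)) (sym (ℙ-compatible ½ ℓ))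
                     (½^-antimono (h²≤crossPairs h ℓ size≡ small)))
      ( Allₚ.filter⁺ (smallClasses? h) (labellings-size r n (2 ℕ.* h))
      , Allₚ.all-filter (smallClasses? h) (labellings r n (2 ℕ.* h)))))
  (scale-½^ (length (balanced r n h)) (h ℕ.* h) t (ℕₚ.≤-trans (ℕₚ.*-monoˡ-≤ (2 ℕ.^ t)
    (ℕₚ.≤-trans (Listₚ.length-filter (smallClasses? h) (labellings r n (2 ℕ.* h)))
                (length-labellings r n (2 ℕ.* h)))) enough))

ℙ-good : ∀ r n h t → (r ℕ.* n) ℕ.^ (2 ℕ.* h) ℕ.* 2 ℕ.^ t ℕ.≤ 2 ℕ.^ (h ℕ.* h) →
          1ℚ - ½ ^ t ≤ ℙ ½ (not ∘ isBad r {n} h)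
ℙ-good r n h t enough = subst (1ℚ - ½ ^ t ≤_) (sym (ℙ-not ½ (isBad r {n} h)))
  (ℚₚ.+-monoʳ-≤ 1ℚ (ℚₚ.neg-antimono-≤ (ℙ-isBad r n h t enough)))

-- Colouring the tuples over a good graph

infix 4 _≼_

-- `ℓ′` arises from `ℓ` by erasing labels, so edges across the classes of `ℓ` serve for `ℓ′` as
-- well.
_≼_ : ∀ {r n} → Labelling r n → Labelling r n → Set
ℓ′ ≼ ℓ = ∀ v {i} → lookup ℓ′ v ≡ just i → lookup ℓ v ≡ just i

nothing∷≼ : ∀ {r n} {a} {ℓ′ ℓ : Labelling r n} → ℓ′ ≼ ℓ → nothing ∷ ℓ′ ≼ a ∷ ℓ
nothing∷≼ sub zero    ()
nothing∷≼ sub (suc v) e = sub v e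

∷≼ : ∀ {r n} {a} {ℓ′ ℓ : Labelling r n} → ℓ′ ≼ ℓ → a ∷ ℓ′ ≼ a ∷ ℓ
∷≼ sub zero    e = e
∷≼ sub (suc v) e = sub v e

classSize-mono-∷ : ∀ {r n} a (i : Fin r) {ℓ′ ℓ : Labelling r n} →
  classSize i ℓ′ ℕ.≤ classSize i ℓ → classSize i (a ∷ ℓ′) ℕ.≤ classSize i (a ∷ ℓ)
classSize-mono-∷ a i le with hasLabel i a
... | true  = ℕ.s≤s le
... | false = le

-- The list `balanced` holds labellings of exactly `2h` vertices; erasing labels brings a larger
-- configuration down to that size without enlarging a class.
shrinkTo : ∀ {r n} m (ℓ : Labelling r n) → m ℕ.≤ size ℓ →
  ∃ λ ℓ′ → size ℓ′ ≡ m × (∀ i → classSize i ℓ′ ℕ.≤ classSize i ℓ) × ℓ′ ≼ ℓ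
shrinkTo zero [] ℕ.z≤n = [] , refl , (λ _ → ℕ.z≤n) , λ ()
shrinkTo m (nothing ∷ ℓ) m≤ with shrinkTo m ℓ m≤
... | ℓ′ , size≡ , cls , sub = nothing ∷ ℓ′ , size≡ , cls , ∷≼ sub
shrinkTo zero (just a ∷ ℓ) _ with shrinkTo zero ℓ ℕ.z≤n
... | ℓ′ , size≡ , cls , sub = nothing ∷ ℓ′ , size≡
  , (λ i → ℕₚ.≤-trans (cls i) (Subsetₚ.∣p∣≤∣x∷p∣ (hasLabel i (just a)) (Vec.map (hasLabel i) ℓ)))
  , nothing∷≼ sub
shrinkTo (suc m) (just a ∷ ℓ) (ℕ.s≤s m≤) with shrinkTo m ℓ m≤
... | ℓ′ , size≡ , cls , sub = just a ∷ ℓ′ , cong suc size≡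
  , (λ i → classSize-mono-∷ (just a) i {ℓ′} {ℓ} (cls i)) , ∷≼ sub

-- Meant for tuples with huge parts, whose classes may exceed `h`. A vertex keeps its label only if
-- fewer than `h` later vertices carry the same one.
capAt : ∀ {r n} h (ℓ : Labelling r n) → ∃ λ ℓ′ → (∀ i → classSize i ℓ′ ≡ classSize i ℓ ℕ.⊓ h) × ℓ′ ≼ ℓ
capAt h [] = [] , (λ _ → refl) , λ ()
capAt h (nothing ∷ ℓ) with capAt h ℓ
... | ℓ′ , cls , sub = nothing ∷ ℓ′ , cls , ∷≼ sub
capAt {r} h (just a ∷ ℓ) with capAt h ℓ | classSize a ℓ ℕₚ.<? h
... | ℓ′ , cls , sub | yes c<h = just a ∷ ℓ′ , cls′ , ∷≼ sub
  where
  cls′ : ∀ i → classSize i (just a ∷ ℓ′) ≡ classSize i (just a ∷ ℓ) ℕ.⊓ h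
  cls′ i with i Finₚ.≟ a
  ... | yes refl = trans (cong suc (trans (cls i) (ℕₚ.m≤n⇒m⊓n≡m (ℕₚ.<⇒≤ c<h)))) (sym (ℕₚ.m≤n⇒m⊓n≡m c<h))
  ... | no _     = cls i
... | ℓ′ , cls , sub | no c≮h = nothing ∷ ℓ′ , cls′ , nothing∷≼ sub
  where
  cls′ : ∀ i → classSize i (nothing ∷ ℓ′) ≡ classSize i (just a ∷ ℓ) ℕ.⊓ h
  cls′ i with i Finₚ.≟ a
  ... | yes refl = trans (cls i) (trans (ℕₚ.m≥n⇒m⊓n≡n (ℕₚ.≮⇒≥ c≮h))
                     (sym (ℕₚ.m≥n⇒m⊓n≡n (ℕₚ.m≤n⇒m≤1+n (ℕₚ.≮⇒≥ c≮h)))))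
  ... | no _     = cls i

twoClasses≤size : ∀ {r n} {i j : Fin r} → i ≢ j → (ℓ : Labelling r n) →
                  classSize i ℓ ℕ.+ classSize j ℓ ℕ.≤ size ℓ
twoClasses≤size i≢j []            = ℕ.z≤n
twoClasses≤size i≢j (nothing ∷ ℓ) = twoClasses≤size i≢j ℓ
twoClasses≤size {i = i} {j} i≢j (just a ∷ ℓ) with twoClasses≤size i≢j ℓ | i Finₚ.≟ a | j Finₚ.≟ a
... | ih | yes refl | yes refl = ⊥-elim (i≢j refl)
... | ih | yes _    | no _     = ℕ.s≤s ih
... | ih | no _     | yes _    = ℕₚ.≤-trans (ℕₚ.≤-reflexive (ℕₚ.+-suc _ _)) (ℕ.s≤s ih)
... | ih | no _     | no _     = ℕₚ.m≤n⇒m≤1+n ih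

∈-class⁺ : ∀ {r n} {i : Fin r} (ℓ : Labelling r n) {v} → lookup ℓ v ≡ just i → v ∈ Vec.map (hasLabel i) ℓ
∈-class⁺ {i = i} ℓ {v} e = Vecₚ.lookup⇒[]= v _
  (trans (Vecₚ.lookup-map v (hasLabel i) ℓ) (trans (cong (hasLabel i) e) self))
  where
  self : hasLabel i (just i) ≡ true
  self with i Finₚ.≟ i
  ... | yes _  = refl
  ... | no i≢i = ⊥-elim (i≢i refl)

∈-class⁻ : ∀ {r n} {i : Fin r} (ℓ : Labelling r n) {v} → v ∈ Vec.map (hasLabel i) ℓ → lookup ℓ v ≡ just i
∈-class⁻ {i = i} ℓ {v} v∈ = inv (lookup ℓ v)
  (trans (sym (Vecₚ.lookup-map v (hasLabel i) ℓ)) (Vecₚ.[]=⇒lookup v∈))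
  where
  inv : ∀ a → hasLabel i a ≡ true → a ≡ just i
  inv (just j) e with i Finₚ.≟ j
  ... | yes refl = refl
  inv (just j) () | no _

∈-support⁺ : ∀ {r n} {i : Fin r} (ℓ : Labelling r n) {v} → lookup ℓ v ≡ just i → v ∈ Vec.map is-just ℓ
∈-support⁺ ℓ {v} e = Vecₚ.lookup⇒[]= v _ (trans (Vecₚ.lookup-map v is-just ℓ) (cong is-just e))

∈-support⁻ : ∀ {r n} (ℓ : Labelling r n) {v} → v ∈ Vec.map is-just ℓ → ∃ λ i → lookup ℓ v ≡ just i
∈-support⁻ ℓ {v} v∈ = inv (lookup ℓ v) (trans (sym (Vecₚ.lookup-map v is-just ℓ)) (Vecₚ.[]=⇒lookup v∈))
  where
  inv : ∀ a → is-just a ≡ true → ∃ λ i → a ≡ just i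
  inv (just i) _ = i , refl

Realises : ∀ {r n} → EdgeBits n → Labelling r n → Set
Realises ω ℓ = ∀ u v {i j} → lookup ℓ u ≡ just i → lookup ℓ v ≡ just j → i ≢ j → T (isEdge ω u v)

∧-T : ∀ {a b} → T a → T b → T (a ∧ b)
∧-T {true} _ tb = tb

realises⇒compatibleRow : ∀ {r n} a (v : Vec Bool n) (ℓ : Labelling r n) →
  (∀ u {i j} → a ≡ just i → lookup ℓ u ≡ just j → i ≢ j → T (lookup v u)) → T (compatibleRow a v ℓ)
realises⇒compatibleRow a []      []      ok = tt
realises⇒compatibleRow a (b ∷ v) (c ∷ ℓ) ok =
  ∧-T (entry a c (ok zero)) (realises⇒compatibleRow a v ℓ (λ u → ok (suc u)))
  where
  entry : ∀ a c → (∀ {i j} → a ≡ just i → c ≡ just j → i ≢ j → T b) → T (not (clash a c) ∨ b)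
  entry nothing  c        ok = tt
  entry (just i) nothing  ok = tt
  entry (just i) (just j) ok with i Finₚ.≟ j
  ... | yes _  = tt
  ... | no i≢j = ok refl refl i≢j

realises⇒compatible : ∀ {r n} (ω : EdgeBits n) (ℓ : Labelling r n) → Realises ω ℓ → T (compatible ω ℓ)
realises⇒compatible []      []      ok = tt
realises⇒compatible (v ∷ ω) (a ∷ ℓ) ok = ∧-T
  (realises⇒compatibleRow a v ℓ (λ u → ok zero (suc u)))
  (realises⇒compatible ω ℓ (λ u w → ok (suc u) (suc w)))

-- With `2h` or more labelled vertices, erasing labels would leave exactly `2h`; classes stay small
-- and cross pairs stay adjacent, so the result would be in the list that `isBad` searches.
good⇒size< : ∀ r {n} h (ω : EdgeBits n) → T (not (isBad r h ω)) → (ℓ : Labelling r n) →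
  SmallClasses h ℓ → Realises ω ℓ → size ℓ ℕ.< 2 ℕ.* h
good⇒size< r h ω good ℓ small real with size ℓ ℕₚ.<? 2 ℕ.* h
... | yes lt = lt
... | no ≮ with shrinkTo (2 ℕ.* h) ℓ (ℕₚ.≮⇒≥ ≮)
... | ℓ′ , size≡ , cls , sub = ⊥-elim (T-not good (Anyₚ.any⁺ (compatible ω)
  (Any.map (λ { refl → realises⇒compatible ω ℓ′ (λ u v e f → real u v (sub u e) (sub v f)) })
    (∈ₚ.∈-filter⁺ (smallClasses? h) (subst (λ m → ℓ′ ∈ˡ labellings r _ m) size≡ (∈-labellings ℓ′))
      (λ i → ℕₚ.≤-trans (cls i) (small i))))))
  where
  T-not : ∀ {b} → T (not b) → ¬ T b
  T-not {false} _ ()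

-- Huge parts, covered vertices and the colour of a tuple

module GoodGraph {r n : ℕ} .{{_ : NonZero r}} (h : ℕ) (ω : EdgeBits n) (good : T (not (isBad r h ω))) where
  private
    module P = GPoset (shiftPoset r (graph ω))
    module Z = Group (ℤ/ r)
    Tuple = HomTuple (K r) (graph ω)

  -- A vertex in two parts would be adjacent to itself.
  disjoint : (A : Tuple) → ∀ {i j v} → v ∈ part A i → v ∈ part A j → i ≡ j
  disjoint A {i} {j} v∈i v∈j with i Finₚ.≟ j
  ... | yes i≡j = i≡j
  ... | no i≢j  = ⊥-elim (Adj-irrefl (graph ω) (complete A i≢j v∈i v∈j))

  label : (A : Tuple) → Fin n → Maybe (Fin r)
  label A v with Finₚ.any? (λ i → v Subsetₚ.∈? part A i)
  ... | yes (i , _) = just i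
  ... | no _        = nothing

  label⁻ : (A : Tuple) → ∀ v {i} → label A v ≡ just i → v ∈ part A i
  label⁻ A v e with Finₚ.any? (λ i → v Subsetₚ.∈? part A i)
  label⁻ A v refl | yes (_ , v∈) = v∈
  label⁻ A v ()   | no _

  label⁺ : (A : Tuple) → ∀ v {i} → v ∈ part A i → label A v ≡ just i
  label⁺ A v {i} v∈ with Finₚ.any? (λ i → v Subsetₚ.∈? part A i)
  ... | yes (_ , v∈′) = cong just (disjoint A v∈′ v∈)
  ... | no none       = ⊥-elim (none (i , v∈))

  labelling : Tuple → Labelling r n
  labelling A = tabulate (label A)

  labelling⁻ : (A : Tuple) → ∀ v {i} → lookup (labelling A) v ≡ just i → v ∈ part A i
  labelling⁻ A v e = label⁻ A v (trans (sym (Vecₚ.lookup∘tabulate (label A) v)) e)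

  labelling⁺ : (A : Tuple) → ∀ v {i} → v ∈ part A i → lookup (labelling A) v ≡ just i
  labelling⁺ A v v∈ = trans (Vecₚ.lookup∘tabulate (label A) v) (label⁺ A v v∈)

  classSize-labelling : ∀ A i → classSize i (labelling A) ≡ ∣ part A i ∣
  classSize-labelling A i = cong ∣_∣ (Subsetₚ.⊆-antisym
    (λ {v} v∈ → labelling⁻ A v (∈-class⁻ (labelling A) v∈))
    (λ {v} v∈ → ∈-class⁺ (labelling A) (labelling⁺ A v v∈)))

  realises : (A : Tuple) → Realises ω (labelling A)
  realises A u v e f i≢j = complete A i≢j (labelling⁻ A u e) (labelling⁻ A v f)

  support : Tuple → Subset n
  support A = Vec.map is-just (labelling A)

  support⁻ : ∀ A {v} → v ∈ support A → ∃ λ i → v ∈ part A i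
  support⁻ A {v} v∈ = let (i , e) = ∈-support⁻ (labelling A) v∈ in i , labelling⁻ A v e

  support⁺ : ∀ A {v i} → v ∈ part A i → v ∈ support A
  support⁺ A {v} v∈ = ∈-support⁺ (labelling A) (labelling⁺ A v v∈)

  Huge : Tuple → Fin r → Set
  Huge A i = h ℕ.≤ ∣ part A i ∣

  -- Capping at `h` leaves exactly `h` vertices in each of two distinct huge parts, hence at least
  -- `2h` labelled vertices in classes of at most `h`, which a good graph excludes.
  huge-unique : ∀ A {i j} → Huge A i → Huge A j → i ≡ j
  huge-unique A {i} {j} hi hj with i Finₚ.≟ j
  ... | yes i≡j = i≡j
  ... | no i≢j with capAt h (labelling A)
  ... | ℓ , cls , sub = ⊥-elim (ℕₚ.<-irrefl refl (ℕₚ.<-≤-trans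
        (good⇒size< r h ω good ℓ (λ k → subst (ℕ._≤ h) (sym (cls k)) (ℕₚ.m⊓n≤n _ h))
          (λ u v e f → realises A u v (sub u e) (sub v f)))
        (subst (ℕ._≤ size ℓ) (cong₂ ℕ._+_ (full hi) (trans (full hj) (sym (ℕₚ.+-identityʳ h))))
          (twoClasses≤size i≢j ℓ))))
    where
    full : ∀ {k} → Huge A k → classSize k ℓ ≡ h
    full {k} hk = trans (cls k) (ℕₚ.m≥n⇒m⊓n≡n (subst (h ℕ.≤_) (sym (classSize-labelling A k)) hk))

  total : Tuple → ℕ
  total A = ∣ support A ∣

  total<2h : ∀ A → (∀ i → ¬ Huge A i) → total A ℕ.< 2 ℕ.* h
  total<2h A none = good⇒size< r h ω good (labelling A)
    (λ i → subst (ℕ._≤ h) (sym (classSize-labelling A i)) (ℕₚ.<⇒≤ (ℕₚ.≰⇒> (none i)))) (realises A)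

  support-mono : ∀ {A B} → A P.⊑ B → support A ⊆ support B
  support-mono {A} {B} A⊑B v∈ = let (i , v∈i) = support⁻ A v∈ in support⁺ B (A⊑B i v∈i)

  -- Equal totals make the supports equal. A vertex of `part B i` then lies in some `part A j`,
  -- hence in `part B j`, and disjointness of the parts of `B` gives `j = i`.
  ⊑∧total≡⇒≈ : ∀ {A B} → A P.⊑ B → total A ≡ total B → A P.≈ B
  ⊑∧total≡⇒≈ {A} {B} A⊑B same i = Subsetₚ.⊆-antisym (A⊑B i) B⊆A
    where
    B⊆A : part B i ⊆ part A i
    B⊆A {v} v∈ with v Subsetₚ.∈? support A
    ... | no v∉  = ⊥-elim (ℕₚ.<-irrefl same
      (Subsetₚ.p⊂q⇒∣p∣<∣q∣ (support-mono {A} {B} A⊑B , v , support⁺ B v∈ , v∉)))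
    ... | yes v∈A with support⁻ A v∈A
    ... | j , v∈j with disjoint B (A⊑B j v∈j) v∈
    ... | refl = v∈j

  -- A relation rather than a function: `colourOf` finds a colour by search, and its invariance
  -- under `≈` then follows from uniqueness.
  IsColour : Tuple → Fin r ⊎ Fin (2 ℕ.* h) → Set
  IsColour A (inj₁ i) = Huge A i
  IsColour A (inj₂ s) = (∀ i → ¬ Huge A i) × toℕ s ≡ total A

  colourOf : ∀ A → ∃ (IsColour A)
  colourOf A with Finₚ.any? (λ i → h ℕₚ.≤? ∣ part A i ∣)
  ... | yes (i , hi) = inj₁ i , hi
  ... | no none      = inj₂ (fromℕ< lt) , (λ i hi → none (i , hi)) , Finₚ.toℕ-fromℕ< lt
    where
    lt = total<2h A (λ i hi → none (i , hi))

  isColour-unique : ∀ A {c d} → IsColour A c → IsColour A d → c ≡ d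
  isColour-unique A {inj₁ i} {inj₁ j} hi hj             = cong inj₁ (huge-unique A hi hj)
  isColour-unique A {inj₁ i} {inj₂ _} hi (none , _)     = ⊥-elim (none i hi)
  isColour-unique A {inj₂ _} {inj₁ j} (none , _) hj     = ⊥-elim (none j hj)
  isColour-unique A {inj₂ s} {inj₂ t} (_ , e) (_ , f)   = cong inj₂ (Finₚ.toℕ-injective (trans e (sym f)))

  isColour-≈ : ∀ {A B c} → A P.≈ B → IsColour A c → IsColour B c
  isColour-≈ {c = inj₁ i} A≈B hi = subst (λ p → h ℕ.≤ ∣ p ∣) (A≈B i) hi
  isColour-≈ {A} {B} {inj₂ s} A≈B (none , e) =
    (λ i hi → none i (subst (λ p → h ℕ.≤ ∣ p ∣) (sym (A≈B i)) hi)) ,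
    trans e (cong ∣_∣ (Subsetₚ.⊆-antisym
      (support-mono {A} {B} (λ i → Subsetₚ.⊆-reflexive (A≈B i)))
      (support-mono {B} {A} (λ i → Subsetₚ.⊆-reflexive (sym (A≈B i))))))

  total-· : ∀ g A → total (g P.· A) ≡ total A
  total-· g A = cong ∣_∣ (Subsetₚ.⊆-antisym
    (λ v∈ → let (i , v∈i) = support⁻ (g P.· A) v∈ in support⁺ A v∈i)
    (λ {v} v∈ → let (i , v∈i) = support⁻ A v∈ in
       -- `g · A` has `part A (j ∙ g)` at position `j`, so part `i` of `A` reappears at position
       -- `i ∙ g⁻¹`.
       support⁺ (g P.· A) {i = i Z.∙ g Z.⁻¹}
         (subst (λ k → v ∈ part A k) (sym (GroupProperties.//-rightDividesˡ (ℤ/ r) g i)) v∈i)))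

  -- Let both tuples have a huge part at `i`. If `A ⊑ g · B`, then `B` has huge parts at `i ∙ g` and
  -- `i`; if `g · B ⊑ A`, then `A` has them at `i ∙ g⁻¹` and `i`. Uniqueness forces `g = ε`. For
  -- size colours, shifts preserve the total, so comparability becomes `A ≈ g · B`.
  comparable⇒colours≢ : ∀ {A B g c} → ¬ (g ≡ Z.ε) → P.Comparable A (g P.· B) → ¬ (A P.≈ g P.· B) →
    IsColour A c → IsColour B c → ⊥
  comparable⇒colours≢ {A} {B} {g} {inj₁ i} g≢ε cmp A≉gB hA hB =
    g≢ε (GroupProperties.identityʳ-unique (ℤ/ r) i g (shifted cmp))
    where
    hgB : Huge (g P.· B) (i Z.∙ g Z.⁻¹)
    hgB = subst (λ k → h ℕ.≤ ∣ part B k ∣) (sym (GroupProperties.//-rightDividesˡ (ℤ/ r) g i)) hB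
    shifted : P.Comparable A (g P.· B) → i Z.∙ g ≡ i
    shifted (inj₁ A⊑gB) = huge-unique B (ℕₚ.≤-trans hA (Subsetₚ.p⊆q⇒∣p∣≤∣q∣ (A⊑gB i))) hB
    shifted (inj₂ gB⊑A) = trans
      (cong (Z._∙ g) (huge-unique A hA (ℕₚ.≤-trans hgB (Subsetₚ.p⊆q⇒∣p∣≤∣q∣ (gB⊑A (i Z.∙ g Z.⁻¹))))))
      (GroupProperties.//-rightDividesˡ (ℤ/ r) g i)
  comparable⇒colours≢ {A} {B} {g} {inj₂ s} _ cmp A≉gB (_ , e) (_ , f) = A≉gB (equal cmp)
    where
    same : total A ≡ total (g P.· B)
    same = trans (sym e) (trans f (sym (total-· g B)))
    equal : P.Comparable A (g P.· B) → A P.≈ g P.· B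
    equal (inj₁ A⊑gB) = ⊑∧total≡⇒≈ {A} {g P.· B} A⊑gB same
    equal (inj₂ gB⊑A) i = sym (⊑∧total≡⇒≈ {g P.· B} {A} gB⊑A (sym same) i)

  colouring : Colouring (strongCompatibilityGraph (shiftPoset r (graph ω))) (r ℕ.+ 2 ℕ.* h)
  colouring = record
    { colour      = λ A → join r (2 ℕ.* h) (proj₁ (colourOf A))
    ; colour-cong = λ {A} {B} A≈B → cong (join r (2 ℕ.* h))
        (isColour-unique B (isColour-≈ {A} {B} {proj₁ (colourOf A)} A≈B (proj₂ (colourOf A))) (proj₂ (colourOf B)))
    ; proper      = λ {A} {B} ((g , g≢ε , cmp) , B∉) same →
        comparable⇒colours≢ {A} {B} {g} g≢ε cmp
          -- `A ≈ g · B` would put `B` into the orbit of `A` through `g⁻¹`.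
          (λ A≈gB → B∉ (g Z.⁻¹ , λ i → sym (trans (A≈gB (i Z.∙ g Z.⁻¹))
              (cong (part B) (GroupProperties.//-rightDividesˡ (ℤ/ r) g i)))))
          (proj₂ (colourOf A))
          (subst (IsColour B) (sym (join-injective same)) (proj₂ (colourOf B)))
    }
    where
    join-injective : ∀ {c d : Fin r ⊎ Fin (2 ℕ.* h)} → join r (2 ℕ.* h) c ≡ join r (2 ℕ.* h) d → c ≡ d
    join-injective {c} {d} e = trans (sym (Finₚ.splitAt-join r (2 ℕ.* h) c))
      (trans (cong (splitAt r) e) (Finₚ.splitAt-join r (2 ℕ.* h) d))

-- Logarithms and real bounds

-- The denominator of `δ` serves as multiplier: the product is the positive numerator.
archimedean : ∀ δ → 0ℚ < δ → ∃ λ d → 1ℚ ≤ fromNat d * δ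
archimedean δ@(mkℚ (+ suc a) d _) _ = suc d , subst (1ℚ ≤_) (sym numerator) (fromNat-mono {1} {suc a} (ℕ.s≤s ℕ.z≤n))
  where
  open ℚᵘₚ.≃-Reasoning
  numerator : fromNat (suc d) * δ ≡ fromNat (suc a)
  numerator = ℚₚ.toℚᵘ-injective (begin
    toℚᵘ (fromNat (suc d) * δ)           ≈⟨ ℚₚ.toℚᵘ-homo-* (fromNat (suc d)) δ ⟩
    toℚᵘ (fromNat (suc d)) ℚᵘ.* toℚᵘ δ   ≈⟨ ℚᵘₚ.*-congʳ {toℚᵘ δ} (ℚₚ.toℚᵘ-fromℚᵘ (mkℚᵘ (+ suc d) 0)) ⟩
    mkℚᵘ (+ suc d) 0 ℚᵘ.* mkℚᵘ (+ suc a) d ≈⟨ *≡* (trans (ℤₚ.*-identityʳ _) (trans (ℤₚ.*-comm (+ suc d) (+ suc a)) (cong (λ k → + suc a ℤ.* + suc k) (sym (ℕₚ.+-identityʳ d))))) ⟩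
    mkℚᵘ (+ suc a) 0                     ≈⟨ ℚₚ.toℚᵘ-fromℚᵘ (mkℚᵘ (+ suc a) 0) ⟨
    toℚᵘ (fromNat (suc a))               ∎)
archimedean (mkℚ (+ zero) d _) (ℚ.*<* (ℤ.+<+ ()))
archimedean (mkℚ ℤ.-[1+ a ] d _) (ℚ.*<* ())

m≤2^m : ∀ m → m ℕ.≤ 2 ℕ.^ m
m≤2^m zero    = ℕ.z≤n
m≤2^m (suc m) = ℕₚ.+-mono-≤ (ℕₚ.m^n>0 2 m) (ℕₚ.≤-trans (m≤2^m m) (ℕₚ.m≤m+n (2 ℕ.^ m) 0))

½^-small : ∀ δ → 0ℚ < δ → ∃ λ t → ½ ^ t ≤ δ
½^-small δ 0<δ with archimedean δ 0<δ
... | d , 1≤dδ = d , (begin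
  ½ ^ d                               ≡⟨ ℚₚ.*-identityʳ _ ⟨
  ½ ^ d * 1ℚ                          ≤⟨ ℚₚ.*-monoˡ-≤-nonNeg (½ ^ d) {{nonNegative (½^-nonNeg d)}} 1≤dδ ⟩
  ½ ^ d * (fromNat d * δ)             ≤⟨ ℚₚ.*-monoˡ-≤-nonNeg (½ ^ d) {{nonNegative (½^-nonNeg d)}}
                                           (ℚₚ.*-monoʳ-≤-nonNeg δ {{nonNegative (ℚₚ.<⇒≤ 0<δ)}} (fromNat-mono (m≤2^m d))) ⟩
  ½ ^ d * (fromNat (2 ℕ.^ d) * δ)     ≡⟨ ℚₚ.*-assoc (½ ^ d) _ δ ⟨
  ½ ^ d * fromNat (2 ℕ.^ d) * δ       ≡⟨ cong (_* δ) (½^*2^ d) ⟩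
  1ℚ * δ                              ≡⟨ ℚₚ.*-identityˡ δ ⟩
  δ                                   ∎)
  where open ℚₚ.≤-Reasoning

floorLog₂ : ∀ n .{{_ : NonZero n}} → ∃ λ l → 2 ℕ.^ l ℕ.≤ n × n ℕ.< 2 ℕ.^ suc l
floorLog₂ n@(suc _) = least-power n (m≤2^m n)
  where
  least-power : ∀ k → n ℕ.≤ 2 ℕ.^ k → ∃ λ l → 2 ℕ.^ l ℕ.≤ n × n ℕ.< 2 ℕ.^ suc l
  least-power zero    n≤ = 0 , ℕ.s≤s ℕ.z≤n , ℕ.s≤s n≤
  least-power (suc k) n≤ with 2 ℕ.^ k ℕₚ.≤? n
  ... | no ≰ = least-power k (ℕₚ.<⇒≤ (ℕₚ.≰⇒> ≰))
  ... | yes 2ᵏ≤n with n ℕₚ.<? 2 ℕ.^ suc k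
  ...   | yes lt = k , 2ᵏ≤n , lt
  -- In this case `n` equals `2 ^ suc k`.
  ...   | no ≮   = suc k , ℕₚ.≮⇒≥ ≮ , ℕₚ.≤-<-trans n≤ (ℕₚ.^-monoʳ-< 2 (ℕ.s≤s (ℕ.s≤s ℕ.z≤n)) {suc k} ℕₚ.≤-refl)

2^-cancel-≤ : ∀ {k l n} → 2 ℕ.^ k ℕ.≤ n → n ℕ.< 2 ℕ.^ suc l → k ℕ.≤ l
2^-cancel-≤ {k} {l} 2ᵏ≤n n<2ˡ⁺¹ = ℕₚ.≮⇒≥ λ l<k →
  ℕₚ.<-irrefl refl (ℕₚ.<-≤-trans n<2ˡ⁺¹ (ℕₚ.≤-trans (ℕₚ.^-monoʳ-≤ 2 l<k) 2ᵏ≤n))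

-- With `w = r + suc l` and `n < 2 ^ suc l` one has `r n ≤ 2 ^ w`. The value `h = 2w + t` makes
-- `h² = 2wh + th`, which exceeds the exponent `2wh` of the count by at least `t`.
threshold : ℕ → ℕ → ℕ → ℕ
threshold r l t = 2 ℕ.* (r ℕ.+ suc l) ℕ.+ t

threshold-enough : ∀ r n l t → n ℕ.< 2 ℕ.^ suc l →
  (r ℕ.* n) ℕ.^ (2 ℕ.* threshold r l t) ℕ.* 2 ℕ.^ t ℕ.≤ 2 ℕ.^ (threshold r l t ℕ.* threshold r l t)
threshold-enough r n l t n< = begin
  (r ℕ.* n) ℕ.^ (2 ℕ.* h) ℕ.* 2 ℕ.^ t    ≤⟨ ℕₚ.*-monoˡ-≤ (2 ℕ.^ t) (ℕₚ.^-monoˡ-≤ (2 ℕ.* h) rn≤) ⟩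
  (2 ℕ.^ w) ℕ.^ (2 ℕ.* h) ℕ.* 2 ℕ.^ t    ≡⟨ cong (ℕ._* 2 ℕ.^ t) (ℕₚ.^-*-assoc 2 w (2 ℕ.* h)) ⟩
  2 ℕ.^ (w ℕ.* (2 ℕ.* h)) ℕ.* 2 ℕ.^ t    ≡⟨ ℕₚ.^-distribˡ-+-* 2 (w ℕ.* (2 ℕ.* h)) t ⟨
  2 ℕ.^ (w ℕ.* (2 ℕ.* h) ℕ.+ t)          ≤⟨ ℕₚ.^-monoʳ-≤ 2 exponents ⟩
  2 ℕ.^ (h ℕ.* h)                        ∎
  where
  open ℕₚ.≤-Reasoning
  open ℕ-Solver
  w h : ℕ
  w = r ℕ.+ suc l
  h = threshold r l t
  rn≤ : r ℕ.* n ℕ.≤ 2 ℕ.^ w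
  rn≤ = begin
    r ℕ.* n                    ≤⟨ ℕₚ.*-mono-≤ (m≤2^m r) (ℕₚ.<⇒≤ n<) ⟩
    2 ℕ.^ r ℕ.* 2 ℕ.^ suc l    ≡⟨ ℕₚ.^-distribˡ-+-* 2 r (suc l) ⟨
    2 ℕ.^ w                    ∎
  1≤h : 1 ℕ.≤ h
  1≤h = ℕₚ.≤-trans (ℕ.s≤s ℕ.z≤n) (ℕₚ.≤-trans (ℕₚ.m≤n+m (suc l) r) (ℕₚ.≤-trans (ℕₚ.m≤m+n w (w ℕ.+ 0)) (ℕₚ.m≤m+n (2 ℕ.* w) t)))
  exponents : w ℕ.* (2 ℕ.* h) ℕ.+ t ℕ.≤ h ℕ.* h
  exponents = begin
    w ℕ.* (2 ℕ.* h) ℕ.+ t          ≡⟨ cong (w ℕ.* (2 ℕ.* h) ℕ.+_) (ℕₚ.*-identityʳ t) ⟨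
    w ℕ.* (2 ℕ.* h) ℕ.+ t ℕ.* 1    ≤⟨ ℕₚ.+-monoʳ-≤ (w ℕ.* (2 ℕ.* h)) (ℕₚ.*-monoʳ-≤ t 1≤h) ⟩
    w ℕ.* (2 ℕ.* h) ℕ.+ t ℕ.* h    ≡⟨ solve 3 (λ w h t → w :* (con 2 :* h) :+ t :* h := (con 2 :* w :+ t) :* h) refl w h t ⟩
    h ℕ.* h                        ∎

-- Lower bounds for the target real

<-offset : ∀ {p q d} → 0ℚ < d → p + d ≡ q → p < q
<-offset {p} {q} {d} 0<d e = subst₂ _<_ (ℚₚ.+-identityʳ p) e (ℚₚ.+-monoʳ-< p 0<d)

-- Equality holds at `r = 2` and `r = 3`, by computation; from `r = 4` on, the first summand
-- suffices.
4≤r+2/[r-1] : ∀ {r} (2≤r : 2 ℕ.≤ r) → fromNat 4 ≤ fromNat r + (+ 2 / (r ∸ 1)) {{2≤⇒nonZero-∸1 2≤r}}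
4≤r+2/[r-1] {suc zero} (ℕ.s≤s ())
4≤r+2/[r-1] {suc (suc zero)}          _ = ℚₚ.≤-refl
4≤r+2/[r-1] {suc (suc (suc zero))}    _ = ℚₚ.≤-refl
4≤r+2/[r-1] {suc (suc (suc (suc s)))} (ℕ.s≤s (ℕ.s≤s _)) = subst (_≤ fromNat (4 ℕ.+ s) + + 2 / (3 ℕ.+ s)) (ℚₚ.+-identityʳ (fromNat 4))
  (ℚₚ.+-mono-≤ (fromNat-mono {4} {4 ℕ.+ s} (ℕₚ.m≤m+n 4 s))
    (ℚₚ.nonNegative⁻¹ (+ 2 / (3 ℕ.+ s)) {{ℚₚ.normalize-nonNeg 2 (3 ℕ.+ s)}}))

open ℝ

⅛ : ℚ
⅛ = + 1 / 8

-- Membership in a lower cut is strict, once for each of `a` and `b` and once for each of the two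
-- sums. Each strict inequality costs `η`, an eighth of `q`, so half of `q` survives.
L-fromℚ+fromℚ+ : ∀ a b (x : ℝ) {c q} → 0ℚ < q → L x q → c ≤ a + b → L (fromℚ a +ℝ fromℚ b +ℝ x) (c + ½ * q)
L-fromℚ+fromℚ+ a b x {c} {q} 0<q lq c≤ =
  a + b - (η + η + η) + q
  , (a + b - (η + η + η) , q
      , ((a - η) + (b - η)
          , (a - η , b - η , (a , refl , <-offset 0<η (solve 2 (λ a η → a :- η :+ η := a) refl a η))
                           , (b , refl , <-offset 0<η (solve 2 (λ b η → b :- η :+ η := b) refl b η)) , refl)
          , <-offset 0<η (solve 3 (λ a b η → a :+ b :- (η :+ η :+ η) :+ η := (a :- η) :+ (b :- η)) refl a b η))
      , lq , refl)
  , ℚₚ.≤-<-trans (ℚₚ.+-monoˡ-≤ (½ * q) c≤)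
      (<-offset 0<η (solve 3 (λ a b q → a :+ b :+ con ½ :* q :+ con ⅛ :* q :=
        a :+ b :- (con ⅛ :* q :+ con ⅛ :* q :+ con ⅛ :* q) :+ q) refl a b q))
  where
  open ℚ-Solver
  η : ℚ
  η = ⅛ * q
  0<η : 0ℚ < η
  0<η = subst (_< η) (ℚₚ.*-zeroʳ ⅛) (ℚₚ.*-monoʳ-<-pos ⅛ 0<q)

*-mono-nonNeg : ∀ {a c s t} → 0ℚ ≤ a → 0ℚ ≤ c → a ≤ s → c ≤ t → a * c ≤ s * t
*-mono-nonNeg {a} {c} {s} {t} 0≤a 0≤c a≤s c≤t = ℚₚ.≤-trans
  (ℚₚ.*-monoʳ-≤-nonNeg c {{nonNegative 0≤c}} a≤s)
  (ℚₚ.*-monoˡ-≤-nonNeg s {{nonNegative (ℚₚ.≤-trans 0≤a a≤s)}} c≤t)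

-- For nonnegative `a` and `c` the product on a box is smallest at the lower corner `(a , c)`. The
-- upper sides are arbitrary and come from locatedness.
fromℚ≤*ℝ : ∀ (x y : ℝ) {a c p} → L x a → L y c → 0ℚ ≤ a → 0ℚ ≤ c → p ≤ a * c → fromℚ p ≤ℝ x *ℝ y
fromℚ≤*ℝ x y {a} {c} la lc 0≤a 0≤c p≤ q (_ , refl , q<p) with located x 1ℚ (ℚₚ.positive⁻¹ 1ℚ) | located y 1ℚ (ℚₚ.positive⁻¹ 1ℚ)
... | _ , b , _ , ub , _ | _ , d , _ , ud , _ =
  a * c , (a , b , c , d , la , ub , lc , ud , λ s t a≤s _ c≤t _ → *-mono-nonNeg 0≤a 0≤c a≤s c≤t)
  , ℚₚ.<-≤-trans q<p p≤

-- Lower cuts are open, so a factor of two is given up: `l` lies strictly below `l + 1`, which is at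
-- most the logarithm.
L-log₂ : ∀ n .{{_ : NonZero n}} l → 2 ℕ.^ suc l ℕ.≤ n → L (log₂ n) (fromNat l)
L-log₂ n l 2ˡ≤n = fromNat (suc l) , (suc l , 0 , subst (2 ℕ.^ suc l ℕ.≤_) (sym (ℕₚ.*-identityʳ n)) 2ˡ≤n , refl)
  , <-offset (ℚₚ.positive⁻¹ 1ℚ) (trans (ℚₚ.+-comm (fromNat l) 1ℚ) (sym (fromNat-+ 1 l)))

-- The part of the number of colours that stays constant as `n` grows.
slack : ℕ → ℕ → ℕ
slack r t = 5 ℕ.* r ℕ.+ 8 ℕ.+ 2 ℕ.* t

colours-split : ∀ r l t → r ℕ.+ 2 ℕ.* threshold r (suc l) t ≡ 4 ℕ.* l ℕ.+ slack r t
colours-split r l t = solve 3 (λ r l t → r :+ con 2 :* (con 2 :* (r :+ (con 2 :+ l)) :+ t) :=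
  con 4 :* l :+ (con 5 :* r :+ con 8 :+ con 2 :* t)) refl r l t
  where open ℕ-Solver

-- Absorbs the constant into the spare `½ * q`: from `1 ≤ e q` and `2 C e ≤ l` follows
-- `C ≤ C e q ≤ ½ q l`.
linear-bound : ∀ {q} e C l → 1ℚ ≤ fromNat e * q → 0ℚ < q → 2 ℕ.* (C ℕ.* e) ℕ.≤ l →
  fromNat (4 ℕ.* l ℕ.+ C) ≤ (fromNat 4 + ½ * q) * fromNat l
linear-bound {q} e C l 1≤eq 0<q l≥ = begin
  fromNat (4 ℕ.* l ℕ.+ C)                            ≡⟨ trans (fromNat-+ (4 ℕ.* l) C) (cong (_+ fromNat C) (fromNat-* 4 l)) ⟩
  fromNat 4 * fromNat l + fromNat C                  ≡⟨ cong (_+_ (fromNat 4 * fromNat l)) (ℚₚ.*-identityʳ (fromNat C)) ⟨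
  fromNat 4 * fromNat l + fromNat C * 1ℚ             ≤⟨ ℚₚ.+-monoʳ-≤ (fromNat 4 * fromNat l) (ℚₚ.*-monoˡ-≤-nonNeg (fromNat C) {{nonNegative (fromNat-nonNeg C)}} 1≤eq) ⟩
  fromNat 4 * fromNat l + fromNat C * (fromNat e * q)
    ≡⟨ solve 4 (λ l c e q → con (fromNat 4) :* l :+ c :* (e :* q) := con (fromNat 4) :* l :+ con ½ :* q :* (con (fromNat 2) :* (c :* e))) refl (fromNat l) (fromNat C) (fromNat e) q ⟩
  fromNat 4 * fromNat l + ½ * q * (fromNat 2 * (fromNat C * fromNat e))
    ≡⟨ cong (λ z → fromNat 4 * fromNat l + ½ * q * z) (trans (fromNat-* 2 (C ℕ.* e)) (cong (fromNat 2 *_) (fromNat-* C e))) ⟨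
  fromNat 4 * fromNat l + ½ * q * fromNat (2 ℕ.* (C ℕ.* e))
    ≤⟨ ℚₚ.+-monoʳ-≤ (fromNat 4 * fromNat l) (ℚₚ.*-monoˡ-≤-nonNeg (½ * q) {{nonNegative (*-nonNeg (ℚₚ.nonNegative⁻¹ ½) (ℚₚ.<⇒≤ 0<q))}} (fromNat-mono l≥)) ⟩
  fromNat 4 * fromNat l + ½ * q * fromNat l          ≡⟨ ℚₚ.*-distribʳ-+ (fromNat l) (fromNat 4) (½ * q) ⟨
  (fromNat 4 + ½ * q) * fromNat l                    ∎
  where
  open ℚₚ.≤-Reasoning
  open ℚ-Solver


-- Comparison with the claimed bound and choice of parameters

coefficient : (r : ℕ) → 2 ℕ.≤ r → ℝ → ℝ
coefficient r 2≤r ε = fromℕ r +ℝ fromℚ ((+ 2 / (r ∸ 1)) {{2≤⇒nonZero-∸1 2≤r}}) +ℝ ε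

L-coefficient : ∀ r 2≤r ε {q} → 0ℚ < q → L ε q → L (coefficient r 2≤r ε) (fromNat 4 + ½ * q)
L-coefficient r 2≤r ε 0<q lq =
  L-fromℚ+fromℚ+ (fromNat r) ((+ 2 / (r ∸ 1)) {{2≤⇒nonZero-∸1 2≤r}}) ε 0<q lq (4≤r+2/[r-1] 2≤r)

colours≤ : ∀ r 2≤r ε {q} n .{{_ : NonZero n}} l t e {k} → 0ℚ < q → L ε q → 1ℚ ≤ fromNat e * q →
  2 ℕ.^ suc l ℕ.≤ n → 2 ℕ.* (slack r t ℕ.* e) ℕ.≤ l → k ℕ.≤ r ℕ.+ 2 ℕ.* threshold r (suc l) t →
  fromℕ k ≤ℝ coefficient r 2≤r ε *ℝ log₂ n
colours≤ r 2≤r ε {q} n l t e {k} 0<q lq 1≤eq 2ˡ≤n B≤l k≤ =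
  fromℚ≤*ℝ (coefficient r 2≤r ε) (log₂ n) {fromNat 4 + ½ * q} {fromNat l} {fromNat k} (L-coefficient r 2≤r ε 0<q lq) (L-log₂ n l 2ˡ≤n)
      (subst (_≤ fromNat 4 + ½ * q) (ℚₚ.+-identityʳ 0ℚ) (ℚₚ.+-mono-≤ (fromNat-nonNeg 4) (*-nonNeg (ℚₚ.nonNegative⁻¹ ½) (ℚₚ.<⇒≤ 0<q))))
      (fromNat-nonNeg l)
      (ℚₚ.≤-trans (fromNat-mono (subst (k ℕ.≤_) (colours-split r l t) k≤)) (linear-bound e (slack r t) l 1≤eq 0<q B≤l))

theorem13 : (ε : ℝ) → fromℕ 0 <ℝ ε →
    (r : ℕ) (2≤r : 2 ℕ.≤ r) →
    WithHighProbability ½ λ n ω →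
    χ[ strongCompatibilityGraph (shiftPoset r {{2≤⇒nonZero 2≤r}} (graph ω)) ]≤
    (fromℕ r +ℝ fromℚ ((+ 2 / (r ∸ 1)) {{2≤⇒nonZero-∸1 2≤r}}) +ℝ ε) *ℝ log₂ n
theorem13 ε (q , (_ , refl , 0<q) , lq) r 2≤r δ 0<δ =
  -- `t` keeps the failure probability below `δ`; `e` says how large `l` must be for the rational
  -- `q`, positive and below `ε`, to absorb the slack.
  let (t , 2⁻ᵗ≤δ) = ½^-small δ 0<δ
      (e , 1≤eq)  = archimedean q 0<q
  -- The extra `suc` in the exponent makes the integer part of the logarithm a successor `suc l`
  -- with `2 * (slack r t * e) ≤ l`, as the strict bound of `L-log₂` requires.
  in 2 ℕ.^ suc (2 ℕ.* (slack r t ℕ.* e)) , whp t e 2⁻ᵗ≤δ 1≤eq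
  where
  instance
    r≢0 : NonZero r
    r≢0 = 2≤⇒nonZero 2≤r
  Event : (n : ℕ) .{{_ : NonZero n}} → EdgeBits n → Set
  Event n ω = χ[ strongCompatibilityGraph (shiftPoset r (graph ω)) ]≤ coefficient r 2≤r ε *ℝ log₂ n
  whp : ∀ t e → ½ ^ t ≤ δ → 1ℚ ≤ fromNat e * q → ∀ n .{{_ : NonZero n}} →
        2 ℕ.^ suc (2 ℕ.* (slack r t ℕ.* e)) ℕ.≤ n → ℙ[ ½ , n ] Event n ≥ (1ℚ - δ)
  whp t e 2⁻ᵗ≤δ 1≤eq n N≤n with floorLog₂ n
  ... | l , 2ˡ≤n , n<2ˡ⁺¹ with 2^-cancel-≤ {suc (2 ℕ.* (slack r t ℕ.* e))} {l} N≤n n<2ˡ⁺¹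
  whp t e 2⁻ᵗ≤δ 1≤eq n N≤n | suc l , 2ˡ≤n , n<2ˡ⁺¹ | ℕ.s≤s B≤l =
    -- Goodness of the graph is the decidable event contained in the one whose probability is
    -- bounded.
    (not ∘ isBad r h) , χ≤ ,
    ℚₚ.≤-trans (ℚₚ.+-monoʳ-≤ 1ℚ (ℚₚ.neg-antimono-≤ 2⁻ᵗ≤δ)) (ℙ-good r n h t (threshold-enough r n (suc l) t n<2ˡ⁺¹))
    where
    h : ℕ
    h = threshold r (suc l) t
    χ≤ : ∀ ω → T (not (isBad r h ω)) → Event n ω
    χ≤ ω good =
      let (k , isχ , k≤) = strongChromaticNumber ω (GoodGraph.colouring h ω good)
      in k , isχ , colours≤ r 2≤r ε n l t e 0<q lq 1≤eq 2ˡ≤n B≤l k≤
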